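{- A complete clique $a$ in an edge-colored graph is exact Gallai if and only if there exist a tree $T$ and a $2$-coloring $\widehat{\bullet}$ of the sibling graph $S(T)$ together with a color-preserving bijection from $a$ onto the leaf graph $K(T)$ such that every factor is irreducible and simple, and higher factors use different colors than lower factors, i.e., for non-leaves $t_1<t_2$ no color occurs both among the edges of the factor at $t_1$ and among the edges of the factor at $t_2$.
   Context: A clique is a complete subgraph induced by a nonempty vertex set, with the restricted coloring. $a$ is exact Gallai if every triangle in it has edges of exactly two distinct colors. A tree is a finite poset in which every pair of unrelated elements has a common upper bound but no common lower bound; parent/child is the covering relation; siblings are unrelated elements with a common parent; leaves are elements with no children. $S(T)$ has vertex set $T$ and edges between siblings; a coloring $\widehat{\bullet}$ of $S(T)$ is a $2$-coloring if for each non-leaf $t$ the edges among children of $t$ use at most two colors. $K(T)$ is the complete graph on the leaves colored by $\overline{st}=\widehat{uv}$, where $u,v$ are the siblings with $s\le u$, $t\le v$. The factor at a non-leaf $t$ is the set of children of $t$, as a complete colored graph with colors $\widehat{rs}$. A partition of a clique into nonempty disjoint subcliques is homogeneous if for any two distinct blocks all edges between them have the same color, nontrivial if it has at least two blocks and not all blocks are singletons; a clique is irreducible if it has no nontrivial homogeneous partition. A monochrome of a colored complete graph is a connected component of the graph formed by the edges of one color. $P_3$ is the path on 4 vertices, $C_5$ the 5-cycle. A clique $a$ is simple if $|a|=2$, or $|a|=4$ and $a$ has two monochromes isomorphic to $P_3$, or $|a|=5$ and $a$ has two monochromes isomorphic to $C_5$. -}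

module Defs where

open import Level using (0ℓ)
open import Data.Nat using (ℕ; suc; _+_)
open import Data.Fin using (Fin; toℕ)
open import Data.Product using (Σ; ∃; ∃-syntax; _×_; _,_)
open import Data.Sum using (_⊎_)
open import Relation.Nullary using (¬_)
open import Relation.Binary using (Rel; IsPartialOrder)
open import Relation.Binary.PropositionalEquality using (_≡_; _≢_)
open import Function.Definitions using (Injective)

-- Colored complete graphs.
-- A colored clique is given by a vertex set P ⊆ Fin k together with a
-- color function κ (only its values on pairs of distinct vertices of P
-- matter).

HasSize : {k : ℕ} → (Fin k → Set) → ℕ → Set
HasSize {k} P r =
  Σ (Fin r → Fin k) λ g →
    Injective _≡_ _≡_ g × (∀ i → P (g i)) × (∀ x → P x → ∃[ i ] g i ≡ x)

ExactlyTwoColors : {C : Set} → C → C → C → Set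
ExactlyTwoColors x y z = (x ≡ y ⊎ y ≡ z ⊎ x ≡ z) × ¬ (x ≡ y × y ≡ z)

IsExactGallai : {C : Set} {n : ℕ} → (Fin n → Fin n → C) → Set
IsExactGallai {n = n} c =
  (i j l : Fin n) → i ≢ j → j ≢ l → i ≢ l → ExactlyTwoColors (c i j) (c j l) (c i l)

-- Partitions of P are given by a block-labelling β : Fin k → Fin k;
-- the blocks are the (nonempty) fibres of β restricted to P.
Homogeneous : {C : Set} {k : ℕ} → (Fin k → Set) → (Fin k → Fin k → C) → (Fin k → Fin k) → Set
Homogeneous {k = k} P κ β =
  (x y x' y' : Fin k) → P x → P y → P x' → P y' →
  β x ≡ β x' → β y ≡ β y' → β x ≢ β y → κ x y ≡ κ x' y'

Nontrivial : {k : ℕ} → (Fin k → Set) → (Fin k → Fin k) → Set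
Nontrivial {k} P β =
  (∃[ x ] ∃[ y ] (P x × P y × β x ≢ β y)) ×
  (∃[ x ] ∃[ y ] (P x × P y × x ≢ y × β x ≡ β y))

Irreducible : {C : Set} {k : ℕ} → (Fin k → Set) → (Fin k → Fin k → C) → Set
Irreducible {k = k} P κ =
  ¬ (Σ (Fin k → Fin k) λ β → Homogeneous P κ β × Nontrivial P β)

-- g : Fin r → P exhibits a monochrome of color c (a connected component
-- of the color-c graph on P) isomorphic to the (connected) graph H on Fin r.
MonochromeIso : {C : Set} {k : ℕ} → (Fin k → Set) → (Fin k → Fin k → C) →
                C → (r : ℕ) → (Fin r → Fin r → Set) → (Fin r → Fin k) → Set
MonochromeIso {k = k} P κ c r H g =
  Injective _≡_ _≡_ g × (∀ i → P (g i)) ×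
  (∀ i j → i ≢ j → (κ (g i) (g j) ≡ c → H i j) × (H i j → κ (g i) (g j) ≡ c)) ×
  (∀ x → P x → (∀ i → g i ≢ x) → ∀ i → κ (g i) x ≢ c)

TwoMonochromes : {C : Set} {k : ℕ} → (Fin k → Set) → (Fin k → Fin k → C) →
                 (r : ℕ) → (Fin r → Fin r → Set) → Set
TwoMonochromes {C} {k} P κ r H =
  Σ C λ c₁ → Σ C λ c₂ → Σ (Fin r → Fin k) λ g₁ → Σ (Fin r → Fin k) λ g₂ →
    MonochromeIso P κ c₁ r H g₁ × MonochromeIso P κ c₂ r H g₂ ×
    (c₁ ≢ c₂ ⊎ ∃[ i ] (∀ j → g₁ i ≢ g₂ j))

P₃ : Fin 4 → Fin 4 → Set
P₃ i j = suc (toℕ i) ≡ toℕ j ⊎ suc (toℕ j) ≡ toℕ i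

C₅ : Fin 5 → Fin 5 → Set
C₅ i j = suc (toℕ i) ≡ toℕ j ⊎ suc (toℕ j) ≡ toℕ i ⊎
         (toℕ i ≡ 0 × toℕ j ≡ 4) ⊎ (toℕ i ≡ 4 × toℕ j ≡ 0)

Simple : {C : Set} {k : ℕ} → (Fin k → Set) → (Fin k → Fin k → C) → Set
Simple P κ =
  HasSize P 2 ⊎
  (HasSize P 4 × TwoMonochromes P κ 4 P₃) ⊎
  (HasSize P 5 × TwoMonochromes P κ 5 C₅)

module _ {m : ℕ} (_≤_ : Rel (Fin m) 0ℓ) where

  _<_ : Fin m → Fin m → Set
  x < y = x ≤ y × x ≢ y

  Unrelated : Fin m → Fin m → Set
  Unrelated x y = ¬ (x ≤ y) × ¬ (y ≤ x)

  IsTree : Set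
  IsTree = IsPartialOrder _≡_ _≤_ ×
    (∀ x y → Unrelated x y →
       (∃[ z ] (x ≤ z × y ≤ z)) × ¬ (∃[ z ] (z ≤ x × z ≤ y)))

  ChildOf : Fin m → Fin m → Set
  ChildOf t s = s < t × (∀ u → ¬ (s < u × u < t))

  Sibling : Fin m → Fin m → Set
  Sibling r s = Unrelated r s × ∃[ t ] (ChildOf t r × ChildOf t s)

  Leaf : Fin m → Set
  Leaf t = ∀ s → ¬ ChildOf t s

  Is2Coloring : {C : Set} → (Fin m → Fin m → C) → Set
  Is2Coloring {C} col = ∀ t → ¬ Leaf t → Σ C λ c₁ → Σ C λ c₂ →
    ∀ r s → ChildOf t r → ChildOf t s → r ≢ s → col r s ≡ c₁ ⊎ col r s ≡ c₂

  KColor : {C : Set} → (Fin m → Fin m → C) → Fin m → Fin m → C → Set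
  KColor col s t x = ∃[ u ] ∃[ v ] (Sibling u v × s ≤ u × t ≤ v × col u v ≡ x)

  FactorColor : {C : Set} → (Fin m → Fin m → C) → Fin m → C → Set
  FactorColor col t x = ∃[ r ] ∃[ s ] (ChildOf t r × ChildOf t s × r ≢ s × col r s ≡ x)

record TreeRep {C : Set} {n : ℕ} (c : Fin n → Fin n → C) : Set₁ where
  field
    m       : ℕ
    _≤T_    : Rel (Fin m) 0ℓ
    isTree  : IsTree _≤T_
    col     : Fin m → Fin m → C
    colSym  : ∀ r s → Sibling _≤T_ r s → col r s ≡ col s r
    is2Col  : Is2Coloring _≤T_ col
    f       : Fin n → Fin m
    f-inj   : Injective _≡_ _≡_ f
    f-leaf  : ∀ i → Leaf _≤T_ (f i)
    f-onto  : ∀ t → Leaf _≤T_ t → ∃[ i ] f i ≡ t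
    f-color : ∀ i j → i ≢ j → KColor _≤T_ col (f i) (f j) (c i j)
    irred   : ∀ t → ¬ Leaf _≤T_ t → Irreducible (ChildOf _≤T_ t) col
    simple  : ∀ t → ¬ Leaf _≤T_ t → Simple (ChildOf _≤T_ t) col
    layered : ∀ t₁ t₂ → ¬ Leaf _≤T_ t₁ → ¬ Leaf _≤T_ t₂ → _<_ _≤T_ t₁ t₂ →
              ∀ x → FactorColor _≤T_ col t₁ x → ¬ FactorColor _≤T_ col t₂ x

{-# OPTIONS --safe #-}
module Submission where

-- From a tree to the triangle condition: of the three nodes at which the branches to the
-- leaves of a triangle part, two coincide and the third is equal to or below them.  If it
-- lies strictly below, the two upper edges agree and the layering separates them from the
-- third; if all three coincide, the triangle sits in one factor, where it has at most two
-- colours and is not monochromatic because neither P₃ nor C₅ has a triangle or an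
-- independent triple.
--
-- Conversely, adding vertices one at a time shows that every clique with two vertices has
-- a homogeneous partition with quotient K₂, P₃ or C₅: a new vertex is joined to everything
-- by one colour, or is a twin of a block, or turns P₃ into C₅, or splits a block of K₂ and
-- produces P₃.  The tree arises by iteration.  Every vertex of K₂, P₃ and C₅ meets every
-- colour of the factor, so a colour repeated further down would give a monochromatic
-- triangle.

open import Defs
open import Level using (0ℓ)
open import Data.Nat using (ℕ; suc; _+_; _∸_; _≤_)
import Data.Nat as ℕ
open import Data.Nat.Induction using (<-wellFounded)
open import Data.Nat.Properties using (1+n≰n)
open import Data.Bool using (Bool; true; false; if_then_else_)
import Data.Bool.Properties as Bool
open import Data.Maybe using (Maybe; just; nothing)
import Data.Maybe.Properties as Maybe
open import Data.Fin using (Fin; zero; suc; toℕ; #_)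
open import Data.Fin.Properties using (_≟_; all?; any?; injective⇒≤; +↔⊎; 1↔⊤)
open import Data.List using (List; []; _∷_; length; filter; allFin)
open import Data.List.Properties using (filter-notAll)
open import Data.List.Membership.Propositional using (_∈_; _∉_; lose)
open import Data.List.Membership.Propositional.Properties using (∈-filter⁺; ∈-filter⁻; ∈-allFin)
open import Data.List.Relation.Unary.Any using (here; there)
open import Data.Vec using (Vec; []; _∷_; tabulate; lookup)
open import Data.Vec.Properties using (lookup∘tabulate)
open import Data.Product using (∃; ∃-syntax; Σ; _×_; _,_; proj₁; proj₂)
open import Data.Sum using (_⊎_; inj₁; inj₂; [_,_]′)
open import Data.Sum.Function.Propositional using (_⊎-↔_)
open import Data.Unit using (tt)
open import Data.Empty using (⊥; ⊥-elim)
open import Function using (_∘_; const; id; case_of_)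
open import Function.Bundles using (_⇔_; mk⇔; _↔_; mk↔ₛ′; Inverse)
open import Function.Definitions using (Injective)
open import Function.Properties.Inverse using (↔-trans; ↔-sym)
open import Induction.WellFounded using (Acc; acc)
open import Relation.Binary using (Rel; IsPartialOrder)
open import Relation.Binary.PropositionalEquality
open import Relation.Nullary using (¬_; Dec; yes; no; does)
open import Relation.Nullary.Decidable
  using (decidable-stable; toWitness; _×-dec_; _⊎-dec_; _→-dec_; ¬?; map′; dec-true; dec-false)

-- Monochromatic triangles

NoMonoTriangle : {C : Set} {k : ℕ} → (Fin k → Set) → (Fin k → Fin k → C) → Set
NoMonoTriangle P κ =
  ∀ {x y z} → P x → P y → P z → x ≢ y → y ≢ z → x ≢ z → ¬ (κ x y ≡ κ y z × κ y z ≡ κ x z)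

-- The graphs whose edges and non-edges form a 2-colouring without monochromatic triangle. The
-- condition is decidable, so `P₃` and `C₅` are checked by evaluation.
Ramsey : {r : ℕ} → (Fin r → Fin r → Set) → Set
Ramsey H = ∀ i j l → i ≢ j → j ≢ l → i ≢ l →
  (H i j ⊎ H j l ⊎ H i l) × ¬ (H i j × H j l × H i l)

ramsey? : ∀ {r} {H : Fin r → Fin r → Set} → (∀ i j → Dec (H i j)) → Dec (Ramsey H)
ramsey? H? = all? λ i → all? λ j → all? λ l →
  ¬? (i ≟ j) →-dec ¬? (j ≟ l) →-dec ¬? (i ≟ l) →-dec
    ((H? i j ⊎-dec H? j l ⊎-dec H? i l) ×-dec ¬? (H? i j ×-dec H? j l ×-dec H? i l))

P₃? : ∀ i j → Dec (P₃ i j)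
P₃? i j = (suc (toℕ i) ℕ.≟ toℕ j) ⊎-dec (suc (toℕ j) ℕ.≟ toℕ i)

C₅? : ∀ i j → Dec (C₅ i j)
C₅? i j = (suc (toℕ i) ℕ.≟ toℕ j) ⊎-dec (suc (toℕ j) ℕ.≟ toℕ i) ⊎-dec
  ((toℕ i ℕ.≟ 0) ×-dec (toℕ j ℕ.≟ 4)) ⊎-dec ((toℕ i ℕ.≟ 4) ×-dec (toℕ j ℕ.≟ 0))

ramsey-P₃ : Ramsey P₃
ramsey-P₃ = toWitness {a? = ramsey? P₃?} _

ramsey-C₅ : Ramsey C₅
ramsey-C₅ = toWitness {a? = ramsey? C₅?} _

no-triple-in-Fin2 : (i j l : Fin 2) → i ≢ j → j ≢ l → ¬ (i ≢ l)
no-triple-in-Fin2 = toWitness {a? = all? λ i → all? λ j → all? λ l →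
  ¬? (i ≟ j) →-dec ¬? (j ≟ l) →-dec ¬? (¬? (i ≟ l))} _

-- Pigeonhole: a missed `x` could be put in front of `h`, and the enumeration of `P` would then give
-- an injection from `suc r` elements into `r`.
injection-onto : ∀ {k r} {P : Fin k → Set} → HasSize P r →
  (h : Fin r → Fin k) → Injective _≡_ _≡_ h → (∀ i → P (h i)) →
  ∀ {x} → P x → ∃[ i ] h i ≡ x
injection-onto {k} {r} {P} (g , _ , _ , g-onto) h h-inj hP {x} px
  with any? (λ i → h i ≟ x)
... | yes found = found
... | no missing = ⊥-elim (1+n≰n (injective⇒≤ {f = proj₁ ∘ index} index-inj))
  where
  x∷h : Fin (suc r) → Fin k
  x∷h zero    = x
  x∷h (suc i) = h i
  x∷hP : ∀ i → P (x∷h i)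
  x∷hP zero    = px
  x∷hP (suc i) = hP i
  x∷h-inj : Injective _≡_ _≡_ x∷h
  x∷h-inj {zero}  {zero}  _ = refl
  x∷h-inj {zero}  {suc j} e = ⊥-elim (missing (j , sym e))
  x∷h-inj {suc i} {zero}  e = ⊥-elim (missing (i , e))
  x∷h-inj {suc i} {suc j} e = cong suc (h-inj e)
  index : ∀ i → ∃[ j ] g j ≡ x∷h i
  index i = g-onto (x∷h i) (x∷hP i)
  index-inj : Injective _≡_ _≡_ (proj₁ ∘ index)
  index-inj {i} {j} e = x∷h-inj
    (trans (sym (proj₂ (index i))) (trans (cong g e) (proj₂ (index j))))

-- The monochrome has as many vertices as `P`, so the triangle pulls back to `H`. It is not
-- independent there, hence one edge has colour `a`; if the colours agreed, all three edges would
-- lie in `H`.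
ramsey⇒noMono : ∀ {C : Set} {k r} {P : Fin k → Set} {κ : Fin k → Fin k → C}
  {H : Fin r → Fin r → Set} {a h} → Ramsey H → HasSize P r →
  MonochromeIso P κ a r H h → NoMonoTriangle P κ
ramsey⇒noMono {κ = κ} {H} {a} {h} ram size (h-inj , hP , edge , _) px py pz x≢y y≢z x≢z (p , q)
  with injection-onto size h h-inj hP px | injection-onto size h h-inj hP py
     | injection-onto size h h-inj hP pz
... | i , refl | j , refl | l , refl =
  [ (λ e → tri (out i≢j e)) , [ (λ e → tri (trans p (out j≢l e)))
                             , (λ e → tri (trans p (trans q (out i≢l e)))) ]′ ]′ (proj₁ found)
  where
  i≢j = x≢y ∘ cong h
  j≢l = y≢z ∘ cong h
  i≢l = x≢z ∘ cong h
  found = ram i j l i≢j j≢l i≢l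
  out : ∀ {i j} → i ≢ j → H i j → κ (h i) (h j) ≡ a
  out ne = proj₂ (edge _ _ ne)
  tri : ¬ (κ (h i) (h j) ≡ a)
  tri e = proj₂ found
    ( proj₁ (edge _ _ i≢j) e
    , proj₁ (edge _ _ j≢l) (trans (sym p) e)
    , proj₁ (edge _ _ i≢l) (trans (sym q) (trans (sym p) e)))

simple⇒noMono : ∀ {C : Set} {k} {P : Fin k → Set} {κ : Fin k → Fin k → C} →
  Simple P κ → NoMonoTriangle P κ
simple⇒noMono (inj₁ (g , _ , _ , onto)) px py pz x≢y y≢z x≢z _
  with onto _ px | onto _ py | onto _ pz
... | i , refl | j , refl | l , refl =
  no-triple-in-Fin2 i j l (x≢y ∘ cong g) (y≢z ∘ cong g) (x≢z ∘ cong g)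
simple⇒noMono (inj₂ (inj₁ (size , _ , _ , _ , _ , mono , _))) = ramsey⇒noMono ramsey-P₃ size mono
simple⇒noMono (inj₂ (inj₂ (size , _ , _ , _ , _ , mono , _))) = ramsey⇒noMono ramsey-C₅ size mono

-- Separating siblings

-- The order is not decidable, so comparability is available only under a double
-- negation; equality of nodes is decidable and hence survives this.
module Separators {m : ℕ} (_≤_ : Rel (Fin m) 0ℓ) (isTree : IsTree _≤_) where

  open IsPartialOrder (proj₁ isTree) using () renaming (trans to ≤-trans; antisym to ≤-antisym)

  Below : Fin m → Fin m → Set
  Below = _<_ _≤_

  comparable : ∀ {s x y} → s ≤ x → s ≤ y → ¬ ¬ (x ≤ y ⊎ y ≤ x)
  comparable sx sy k =
    proj₂ (proj₂ isTree _ _ ((λ p → k (inj₁ p)) , (λ p → k (inj₂ p)))) (_ , sx , sy)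

  child-comparable : ∀ {t u v} → ChildOf _≤_ t u → ChildOf _≤_ t v → u ≤ v → u ≡ v
  child-comparable {u = u} {v} (_ , cover) (v<t , _) u≤v with u ≟ v
  ... | yes e = e
  ... | no ne = ⊥-elim (cover v ((u≤v , ne) , v<t))

  -- Two children above a common element are comparable, and comparable children of one node
  -- coincide by covering.
  child-unique : ∀ {s t u v} → ChildOf _≤_ t u → ChildOf _≤_ t v → s ≤ u → s ≤ v → u ≡ v
  child-unique cu cv su sv = decidable-stable (_ ≟ _) λ ne → comparable su sv
    [ ne ∘ child-comparable cu cv , ne ∘ sym ∘ child-comparable cv cu ]′

  child-unrelated : ∀ {t u v} → ChildOf _≤_ t u → ChildOf _≤_ t v → u ≢ v → Unrelated _≤_ u v
  child-unrelated cu cv ne = ne ∘ child-comparable cu cv , ne ∘ sym ∘ child-comparable cv cu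

  -- Over `s` the elements `t` and `u` are comparable; `u` strictly below `t` would put `t` strictly
  -- between `u` and its parent.
  below-child : ∀ {s t t' u} → s ≤ t → Below t t' → ChildOf _≤_ t' u → s ≤ u → ¬ ¬ (t ≤ u)
  below-child {t = t} {u = u} st t<t' (_ , cover) su k = comparable st su
    [ k , (λ u≤t → cover t ((u≤t , λ { refl → k u≤t }) , t<t')) ]′

  -- The siblings that colour the edge from `s` to `r` in the leaf graph, kept together with their
  -- parent; `top` acts as the least common ancestor.
  record Separator (s r : Fin m) : Set where
    field
      {top left right} : Fin m
      left-child  : ChildOf _≤_ top left
      right-child : ChildOf _≤_ top right
      unrelated   : Unrelated _≤_ left right
      s≤left      : s ≤ left
      r≤right     : r ≤ right

    s≤top : s ≤ top
    s≤top = ≤-trans s≤left (proj₁ (proj₁ left-child))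

    r≤top : r ≤ top
    r≤top = ≤-trans r≤right (proj₁ (proj₁ right-child))

    siblings : Sibling _≤_ left right
    siblings = unrelated , top , left-child , right-child

    left≢right : left ≢ right
    left≢right e = proj₁ unrelated (subst (left ≤_) e (IsPartialOrder.refl (proj₁ isTree)))

  open Separator

  flip : ∀ {s r} → Separator s r → Separator r s
  flip a = record
    { left-child = right-child a ; right-child = left-child a
    ; unrelated = proj₂ (unrelated a) , proj₁ (unrelated a)
    ; s≤left = r≤right a ; r≤right = s≤left a }

  -- Otherwise `top a` would lie below both siblings of `b`, but unrelated elements have no common
  -- lower bound.
  top-not-below : ∀ {s r} (a b : Separator s r) → ¬ Below (top a) (top b)
  top-not-below a b lt =
    below-child (s≤top a) lt (left-child b) (s≤left b) λ p →
    below-child (r≤top a) lt (right-child b) (r≤right b) λ q →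
    proj₂ (proj₂ isTree _ _ (unrelated b)) (_ , p , q)

  top-unique : ∀ {s r} (a b : Separator s r) → top a ≡ top b
  top-unique a b = decidable-stable (_ ≟ _) λ ne → comparable (s≤top a) (s≤top b)
    [ (λ p → top-not-below a b (p , ne)) , (λ p → top-not-below b a (p , ne ∘ sym)) ]′

  -- The node `top a` lies below `left b`, hence so does `i`, and the siblings of `b` separate `i`
  -- from `l` as well.
  upper-top : ∀ {i j l} (a : Separator i j) (b : Separator j l) (e : Separator i l) →
    Below (top a) (top b) → top e ≡ top b
  upper-top a b e lt = decidable-stable (_ ≟ _) λ ne →
    below-child (r≤top a) lt (left-child b) (s≤left b) λ p →
    ne (top-unique e (record
      { left-child = left-child b ; right-child = right-child b ; unrelated = unrelated b
      ; s≤left = ≤-trans (s≤top a) p ; r≤right = r≤right b }))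

  -- Both `top a` and `top b` lie above `j`, so one is above the other, and by `upper-top` the
  -- higher one is `top e`.
  two-tops-agree : ∀ {i j l} (a : Separator i j) (b : Separator j l) (e : Separator i l) →
    ¬ (top a ≢ top b × top e ≢ top a × top e ≢ top b)
  two-tops-agree a b e (ab , ea , eb) = comparable (r≤top a) (s≤top b)
    [ (λ p → eb (upper-top a b e (p , ab)))
    , (λ p → ea (upper-top (flip b) (flip a) (flip e) (p , ab ∘ sym))) ]′

  -- Over `i` the two nodes are comparable; were `top e` the higher one, `upper-top` would make it
  -- equal to `top b`.
  lower-top : ∀ {i j l} (a : Separator i j) (b : Separator j l) (e : Separator i l) →
    top a ≡ top b → top e ≢ top a → ¬ ¬ Below (top e) (top a)
  lower-top a b e ab ea k = comparable (s≤top a) (s≤top e)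
    [ (λ p → ea (trans (sym (upper-top (flip a) e b (p , ea ∘ sym))) (sym ab)))
    , (λ p → k (p , ea)) ]′

-- Triangles in a clique represented by a tree

module FromTree {C : Set} {n : ℕ} (c : Fin n → Fin n → C) (rep : TreeRep c) where

  open TreeRep rep
  open Separators _≤T_ isTree
  open Separator

  shade : ∀ {s r} → Separator s r → C
  shade a = col (left a) (right a)

  shade-flip : ∀ {s r} (a : Separator s r) → shade (flip a) ≡ shade a
  shade-flip a = sym (colSym _ _ (siblings a))

  top-inner : ∀ {s r} (a : Separator s r) → ¬ Leaf _≤T_ (top a)
  top-inner a leaf = leaf _ (left-child a)

  shade-in-factor : ∀ {s r} (a : Separator s r) → FactorColor _≤T_ col (top a) (shade a)
  shade-in-factor a = _ , _ , left-child a , right-child a , left≢right a , refl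

  -- At the shared top, `i` and `l` lie under the same child, since distinct children would separate
  -- them there. So the edges at `j` are coloured by one pair of siblings, while `top e` is strictly
  -- lower and layering applies.
  apex : ∀ {i j l} (a : Separator i j) (b : Separator j l) (e : Separator i l) →
    top a ≡ top b → top e ≢ top a → shade a ≡ shade b × shade e ≢ shade a
  apex a b e ab ea =
    trans (cong₂ col outer inner) (sym (colSym _ _ (siblings b))) , λ q →
      lower-top a b e ab ea λ lt →
      layered _ _ (top-inner e) (top-inner a) lt _ (shade-in-factor e)
        (subst (FactorColor _≤T_ col (top a)) (sym q) (shade-in-factor a))
    where
    right-b : ChildOf _≤T_ (top a) (right b)
    right-b = subst (λ t → ChildOf _≤T_ t _) (sym ab) (right-child b)
    inner : right a ≡ left b
    inner = child-unique (right-child a)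
      (subst (λ t → ChildOf _≤T_ t _) (sym ab) (left-child b)) (r≤right a) (s≤left b)
    outer : left a ≡ right b
    outer = decidable-stable (_ ≟ _) λ ne → ea (top-unique e (record
      { left-child = left-child a ; right-child = right-b
      ; unrelated = child-unrelated (left-child a) right-b ne
      ; s≤left = s≤left a ; r≤right = r≤right b }))

  two-of-three : {x y z p q : C} → (x ≡ p ⊎ x ≡ q) → (y ≡ p ⊎ y ≡ q) → (z ≡ p ⊎ z ≡ q) →
    x ≡ y ⊎ y ≡ z ⊎ x ≡ z
  two-of-three (inj₁ a) (inj₁ b) _        = inj₁ (trans a (sym b))
  two-of-three (inj₂ a) (inj₂ b) _        = inj₁ (trans a (sym b))
  two-of-three _        (inj₁ b) (inj₁ d) = inj₂ (inj₁ (trans b (sym d)))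
  two-of-three _        (inj₂ b) (inj₂ d) = inj₂ (inj₁ (trans b (sym d)))
  two-of-three (inj₁ a) _        (inj₁ d) = inj₂ (inj₂ (trans a (sym d)))
  two-of-three (inj₂ a) _        (inj₂ d) = inj₂ (inj₂ (trans a (sym d)))

  factor-triangle : ∀ {t x y z} → ChildOf _≤T_ t x → ChildOf _≤T_ t y → ChildOf _≤T_ t z →
    x ≢ y → y ≢ z → x ≢ z → ExactlyTwoColors (col x y) (col y z) (col x z)
  factor-triangle {t} cx cy cz x≢y y≢z x≢z =
    two-of-three (two _ _ cx cy x≢y) (two _ _ cy cz y≢z) (two _ _ cx cz x≢z) ,
    simple⇒noMono (simple t inner) cx cy cz x≢y y≢z x≢z
    where
    inner : ¬ Leaf _≤T_ t
    inner leaf = leaf _ cx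
    two = proj₂ (proj₂ (is2Col t inner))

  -- By `child-unique` the six ends of the separators are only three children, which form a triangle
  -- of one factor.
  common-top : ∀ {i j l} (a : Separator i j) (b : Separator j l) (e : Separator i l) →
    top a ≡ top b → top a ≡ top e → ExactlyTwoColors (shade a) (shade b) (shade e)
  common-top
    a@(record { left-child = la ; right-child = ra })
    b@(record { left-child = lb ; right-child = rb })
    e@(record { left-child = le ; right-child = re }) refl refl
    with child-unique ra lb (r≤right a) (s≤left b)
       | child-unique la le (s≤left a) (s≤left e)
       | child-unique rb re (r≤right b) (r≤right e)
  ... | refl | refl | refl =
    factor-triangle la lb rb (left≢right a) (left≢right b) (left≢right e)

  shades : ∀ {i j l} (a : Separator i j) (b : Separator j l) (e : Separator i l) →
    ExactlyTwoColors (shade a) (shade b) (shade e)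
  shades a b e with top a ≟ top b | top e ≟ top a | top e ≟ top b
  ... | yes ab | yes ea | _ = common-top a b e ab (sym ea)
  ... | yes ab | no ea | _ with apex a b e ab ea
  ...   | p , q = inj₁ p , λ (x , y) → q (sym (trans x y))
  shades a b e | no ab | yes ea | _ with apex (flip a) e b (sym ea) (ab ∘ sym)
  ...   | p , q = inj₂ (inj₂ (trans (sym (shade-flip a)) p)) ,
                  λ (x , _) → q (trans (sym x) (sym (shade-flip a)))
  shades a b e | no ab | no ea | yes eb with apex b (flip e) (flip a) (sym eb) ab
  ...   | p , q = inj₂ (inj₁ (trans p (shade-flip e))) , λ (x , _) → q (trans (shade-flip a) x)
  shades a b e | no ab | no ea | no eb = ⊥-elim (two-tops-agree a b e (ab , ea , eb))

  separate : ∀ {i j} → i ≢ j → Σ (Separator (f i) (f j)) λ a → shade a ≡ c i j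
  separate {i} {j} ne with f-color i j ne
  ... | _ , _ , (unr , _ , cu , cv) , fu , fv , e = record
    { left-child = cu ; right-child = cv ; unrelated = unr ; s≤left = fu ; r≤right = fv } , e

  exactGallai : IsExactGallai c
  exactGallai i j l i≢j j≢l i≢l
    with separate i≢j | separate j≢l | separate i≢l
  ... | a , p | b , q | e , r rewrite sym p | sym q | sym r = shades a b e

-- The factors K₂, P₃ and C₅

-- Allows the facts about small graphs below to be settled by running through all subsets and all
-- colour patterns.
Exhaustible : Set → Set₁
Exhaustible A = ∀ {P : A → Set} → (∀ a → Dec (P a)) → Dec (∀ a → P a)

allBool? : Exhaustible Bool
allBool? P? = map′ (λ { (t , f) true → t ; (t , f) false → f }) (λ h → h true , h false)
  (P? true ×-dec P? false)

allMaybe? : ∀ {A} → Exhaustible A → Exhaustible (Maybe A)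
allMaybe? all P? = map′ (λ { (n , j) nothing → n ; (n , j) (just a) → j a })
  (λ h → h nothing , h ∘ just) (P? nothing ×-dec all (P? ∘ just))

allVec? : ∀ {A} → Exhaustible A → ∀ {k} → Exhaustible (Vec A k)
allVec? all {ℕ.zero} P? = map′ (λ { p [] → p }) (λ h → h []) (P? [])
allVec? all {suc k} P? = map′ (λ { h (a ∷ v) → h a v }) (λ h a v → h (a ∷ v))
  (all λ a → allVec? all λ v → P? (a ∷ v))

data Shape : Set where
  two four five : Shape

arity-2 : Shape → ℕ
arity-2 two  = 0
arity-2 four = 2
arity-2 five = 3

Ix : Shape → Set
Ix s = Fin (suc (suc (arity-2 s)))

-- The absolute difference: one of the two truncated differences vanishes. In the pentagon, distance
-- 4 is the closing edge.
dist : ∀ {k} → Fin k → Fin k → ℕ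
dist i j = (toℕ i ∸ toℕ j) + (toℕ j ∸ toℕ i)

-- The edges labelled true form K₂, P₃ and C₅ respectively, those labelled false the complement.
edge : (s : Shape) → Ix s → Ix s → Bool
edge two  i j = true
edge four i j = does (dist i j ℕ.≟ 1)
edge five i j = does ((dist i j ℕ.≟ 1) ⊎-dec (dist i j ℕ.≟ 4))

all-shapes : {P : Shape → Set} → P two → P four → P five → ∀ s → P s
all-shapes p q r two  = p
all-shapes p q r four = q
all-shapes p q r five = r

edge-sym : ∀ s i j → edge s i j ≡ edge s j i
edge-sym = all-shapes
  (toWitness {a? = check two} tt) (toWitness {a? = check four} tt) (toWitness {a? = check five} tt)
  where
  check : ∀ s → Dec (∀ i j → edge s i j ≡ edge s j i)
  check s = all? λ i → all? λ j → edge s i j Bool.≟ edge s j i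

Meets : (s : Shape) → Ix s → Bool → Set
Meets s i e = ∃[ j ] (i ≢ j × edge s i j ≡ e)

meets? : ∀ s i e → Dec (Meets s i e)
meets? s i e = any? λ j → ¬? (i ≟ j) ×-dec (edge s i j Bool.≟ e)

-- Restricted to labels that occur on an edge, because `false` labels no edge of K₂.
edge-meets-all : ∀ s {a b} → a ≢ b → ∀ i → Meets s i (edge s a b)
edge-meets-all s {a} {b} a≢b i = all-shapes {λ s → ∀ a b → a ≢ b → ∀ i → Meets s i (edge s a b)}
  (toWitness {a? = check two} tt) (toWitness {a? = check four} tt) (toWitness {a? = check five} tt)
  s a b a≢b i
  where
  check : ∀ s → Dec (∀ a b → a ≢ b → ∀ i → Meets s i (edge s a b))
  check s = all? λ a → all? λ b → ¬? (a ≟ b) →-dec all? λ i → meets? s i (edge s a b)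

Module : (s : Shape) → (Ix s → Bool) → Set
Module s S = ∀ i j l → S i ≡ true → S j ≡ true → S l ≡ false → edge s i l ≡ edge s j l

-- K₂, P₃ and C₅ are prime for modular decomposition. Subsets are coded as vectors so that they can
-- be enumerated.
modules-trivial : ∀ s (S : Vec Bool _) → Module s (lookup S) →
  ∀ i j → i ≢ j → lookup S i ≡ true → lookup S j ≡ true → ∀ l → lookup S l ≡ true
modules-trivial = all-shapes
  (toWitness {a? = check two} tt) (toWitness {a? = check four} tt) (toWitness {a? = check five} tt)
  where
  check : ∀ s → Dec (∀ (S : Vec Bool _) → Module s (lookup S) →
    ∀ i j → i ≢ j → lookup S i ≡ true → lookup S j ≡ true → ∀ l → lookup S l ≡ true)
  check s = allVec? allBool? λ S →
    (all? λ i → all? λ j → all? λ l →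
      (lookup S i Bool.≟ true) →-dec (lookup S j Bool.≟ true) →-dec (lookup S l Bool.≟ false)
        →-dec (edge s i l Bool.≟ edge s j l))
    →-dec (all? λ i → all? λ j → ¬? (i ≟ j) →-dec
      (lookup S i Bool.≟ true) →-dec (lookup S j Bool.≟ true) →-dec
      all? λ l → lookup S l Bool.≟ true)

-- Attaching a vertex to a factor

-- A colour is classified by the palette entry that it equals, if any.
Class : Set
Class = Maybe Bool

_≟ᶜ_ : (p q : Class) → Dec (p ≡ q)
_≟ᶜ_ = Maybe.≡-dec Bool._≟_

-- The condition on a triangle with one edge of palette colour e and two of classes p and q.
Fits : Bool → Class → Class → Set
Fits e p q = (p ≡ just e × q ≢ just e) ⊎ (q ≡ just e × p ≢ just e) ⊎ (p ≡ q × p ≢ just e)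

fits? : ∀ e p q → Dec (Fits e p q)
fits? e p q = ((p ≟ᶜ just e) ×-dec ¬? (q ≟ᶜ just e)) ⊎-dec
  ((q ≟ᶜ just e) ×-dec ¬? (p ≟ᶜ just e)) ⊎-dec ((p ≟ᶜ q) ×-dec ¬? (p ≟ᶜ just e))

Pattern : Shape → Set
Pattern s = Vec Class (suc (suc (arity-2 s)))

Valid : ∀ s → Pattern s → Set
Valid s f = ∀ i j → i ≢ j → Fits (edge s i j) (lookup f i) (lookup f j)

Rigid : ∀ s → Pattern s → Ix s → Set
Rigid s f l = ∀ p → (∀ i → l ≢ i → Fits (edge s l i) p (lookup f i)) → p ≡ lookup f l

-- Rigidity transfers the class of one representative to all vertices of its block.
Pinned : ∀ s → Pattern s → Ix s → Class → Set
Pinned s f l p = lookup f l ≡ p × Rigid s f l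

-- The new vertex closes the path to a 5-cycle: it becomes vertex `zero`, and vertex `l` of the path
-- becomes `suc l`.
Pentagon : ∀ s → Pattern s → Set
Pentagon two  f = ⊥
Pentagon four f = ∀ l → Pinned four f l (just (edge five zero (suc l)))
Pentagon five f = ⊥

-- The alternatives: every edge to the new vertex avoids the palette; or the new vertex is a twin of
-- block `j`, with its edges into that block left free; or it completes a pentagon.
Position : ∀ s → Pattern s → Set
Position s f =
  (∀ l → Pinned s f l nothing) ⊎
  (∃[ j ] ∀ l → j ≢ l → Pinned s f l (just (edge s j l))) ⊎
  Pentagon s f

pinned? : ∀ s f l p → Dec (Pinned s f l p)
pinned? s f l p = (lookup f l ≟ᶜ p) ×-dec allMaybe? allBool? λ q →
  (all? λ i → ¬? (l ≟ i) →-dec fits? (edge s l i) q (lookup f i)) →-dec (q ≟ᶜ lookup f l)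

pentagon? : ∀ s f → Dec (Pentagon s f)
pentagon? two  f = no λ ()
pentagon? four f = all? λ l → pinned? four f l _
pentagon? five f = no λ ()

position? : ∀ s f → Dec (Position s f)
position? s f =
  (all? λ l → pinned? s f l nothing) ⊎-dec
  (any? λ j → all? λ l → ¬? (j ≟ l) →-dec pinned? s f l (just (edge s j l))) ⊎-dec
  pentagon? s f

valid⇒position? : ∀ s → Dec (∀ f → Valid s f → Position s f)
valid⇒position? s = allVec? (allMaybe? allBool?) λ f →
  (all? λ i → all? λ j → ¬? (i ≟ j) →-dec fits? (edge s i j) (lookup f i) (lookup f j))
  →-dec position? s f

-- Checked over all 81 patterns on P₃ and all 243 on C₅. K₂ is treated in `Pair`, since there a
-- block may split.
valid⇒position : ∀ s → s ≢ two → ∀ f → Valid s f → Position s f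
valid⇒position two  ne = ⊥-elim (ne refl)
valid⇒position four _  = toWitness {a? = valid⇒position? four} tt
valid⇒position five _  = toWitness {a? = valid⇒position? five} tt

edge-meets-both : ∀ s → s ≢ two → ∀ i e → Meets s i e
edge-meets-both two  ne = ⊥-elim (ne refl)
edge-meets-both four _  = toWitness {a? = all? λ i → allBool? (meets? four i)} tt
edge-meets-both five _  = toWitness {a? = all? λ i → allBool? (meets? five i)} tt

path-in-pentagon : ∀ i j → edge four i j ≡ edge five (suc i) (suc j)
path-in-pentagon = toWitness
  {a? = all? λ i → all? λ j → edge four i j Bool.≟ edge five (suc i) (suc j)} tt

Exhibits : ∀ s → (Ix s → Ix s → Set) → Bool → (Ix s → Ix s) → Set
Exhibits s H b σ =
  (∀ i j → σ i ≡ σ j → i ≡ j) × (∀ l → ∃[ i ] σ i ≡ l) ×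
  (∀ i j → i ≢ j → (edge s (σ i) (σ j) ≡ b → H i j) × (H i j → edge s (σ i) (σ j) ≡ b))

exhibits? : ∀ s {H} → (∀ i j → Dec (H i j)) → ∀ b σ → Dec (Exhibits s H b σ)
exhibits? s H? b σ =
  (all? λ i → all? λ j → (σ i ≟ σ j) →-dec (i ≟ j)) ×-dec
  (all? λ l → any? λ i → σ i ≟ l) ×-dec
  (all? λ i → all? λ j → ¬? (i ≟ j) →-dec
    (((edge s (σ i) (σ j) Bool.≟ b) →-dec H? i j) ×-dec
     (H? i j →-dec (edge s (σ i) (σ j) Bool.≟ b))))

path : Exhibits four P₃ true id
path = toWitness {a? = exhibits? four P₃? true id} tt

-- The complement of the path 0, 1, 2, 3 is again a path, traversed in this order.
copath : Exhibits four P₃ false (lookup (# 1 ∷ # 3 ∷ # 0 ∷ # 2 ∷ []))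
copath = toWitness {a? = exhibits? four P₃? false _} tt

cycle : Exhibits five C₅ true id
cycle = toWitness {a? = exhibits? five C₅? true id} tt

-- The complement of the pentagon is the pentagram, traversed in steps of two.
cocycle : Exhibits five C₅ false (lookup (# 0 ∷ # 2 ∷ # 4 ∷ # 1 ∷ # 3 ∷ []))
cocycle = toWitness {a? = exhibits? five C₅? false _} tt

search : {A : Set} {P Q : A → Set} (xs : List A) → (∀ {x} → x ∈ xs → P x ⊎ Q x) →
  (∀ {x} → x ∈ xs → P x) ⊎ (∃[ x ] (x ∈ xs × Q x))
search []       _ = inj₁ λ ()
search (x ∷ xs) h with h (here refl) | search xs (h ∘ there)
... | inj₂ q | _                  = inj₂ (x , here refl , q)
... | inj₁ p | inj₂ (y , y∈ , q)  = inj₂ (y , there y∈ , q)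
... | inj₁ p | inj₁ all           = inj₁ λ { (here refl) → p ; (there y∈) → all y∈ }

another : ∀ {k} (i : Fin (suc (suc k))) → ∃[ j ] j ≢ i
another zero    = suc zero , λ ()
another (suc i) = zero , λ ()

Σ-finite : ∀ {k} {P : Fin k → Set} → (∀ i → ∃[ m ] (P i ↔ Fin m)) → ∃[ m ] (Σ (Fin k) P ↔ Fin m)
Σ-finite {ℕ.zero} h = 0 , mk↔ₛ′ (λ ()) (λ ()) (λ ()) (λ ())
Σ-finite {suc k} {P} h with h zero | Σ-finite (h ∘ suc)
... | m , iso | l , isos = m + l , ↔-trans
  (mk↔ₛ′ (λ { (zero , p) → inj₁ p ; (suc i , p) → inj₂ (i , p) })
         (λ { (inj₁ p) → zero , p ; (inj₂ (i , p)) → suc i , p })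
         (λ { (inj₁ _) → refl ; (inj₂ _) → refl })
         (λ { (zero , _) → refl ; (suc _ , _) → refl }))
  (↔-trans (iso ⊎-↔ isos) (↔-sym +↔⊎))

-- Injectivity on the labels that occur on edges. A constant palette is thus faithful for K₂, while
-- for P₃ and C₅, where both labels occur, this is full injectivity.
Faithful : {C : Set} (s : Shape) → (Bool → C) → Set
Faithful s palette = ∀ {i j k l} → i ≢ j → k ≢ l →
  palette (edge s i j) ≡ palette (edge s k l) → edge s i j ≡ edge s k l

faithful⇒injective : ∀ {C : Set} s {palette : Bool → C} → s ≢ two → Faithful s palette →
  ∀ {a b} → palette a ≡ palette b → a ≡ b
faithful⇒injective s ne faithful {a} {b} e
  with edge-meets-both s ne zero a | edge-meets-both s ne zero b
... | _ , p , refl | _ , q , refl = faithful p q e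

-- Factors of a prescribed shape

record Factor {C N : Set} (P : N → Set) (κ : N → N → C) : Set where
  field
    shape    : Shape
    palette  : Bool → C
    faithful : Faithful shape palette
    kid      : Ix shape → N
    kid-inj  : ∀ {i j} → kid i ≡ kid j → i ≡ j
    kid∈     : ∀ i → P (kid i)
    onto     : ∀ {x} → P x → ∃[ i ] kid i ≡ x
    color    : ∀ {i j} → i ≢ j → κ (kid i) (kid j) ≡ palette (edge shape i j)

-- Carries a factor from a subtree to the whole tree, and from tree positions to their numbers in
-- `Fin m`.
map-factor : ∀ {C N N′ : Set} {P : N → Set} {κ : N → N → C} {P′ : N′ → Set} {κ′ : N′ → N′ → C}
  (h : N → N′) → (∀ {x y} → h x ≡ h y → x ≡ y) → (∀ {x} → P x → P′ (h x)) →
  (∀ {y} → P′ y → ∃[ x ] (P x × h x ≡ y)) → (∀ x y → κ′ (h x) (h y) ≡ κ x y) →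
  Factor P κ → Factor P′ κ′
map-factor h h-inj h∈ h-onto h-color F = record
  { shape = shape ; palette = palette ; faithful = faithful
  ; kid = h ∘ kid ; kid-inj = kid-inj ∘ h-inj ; kid∈ = h∈ ∘ kid∈
  ; onto = λ py → let (x , px , e) = h-onto py ; (i , e′) = onto px in i , trans (cong h e′) e
  ; color = λ ne → trans (h-color _ _) (color ne) }
  where open Factor F

module _ {C : Set} {k : ℕ} {P : Fin k → Set} {κ : Fin k → Fin k → C} (F : Factor P κ) where

  open Factor F

  factor-two-colors : ∃[ a ] ∃[ b ] (∀ {x y} → P x → P y → x ≢ y → κ x y ≡ a ⊎ κ x y ≡ b)
  factor-two-colors = palette true , palette false , λ px py x≢y → go (onto px) (onto py) x≢y
    where
    either : ∀ e {z} → z ≡ palette e → z ≡ palette true ⊎ z ≡ palette false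
    either true  = inj₁
    either false = inj₂
    go : ∀ {x y} → ∃[ i ] kid i ≡ x → ∃[ j ] kid j ≡ y → x ≢ y →
      κ x y ≡ palette true ⊎ κ x y ≡ palette false
    go (i , refl) (j , refl) ne = either _ (color (ne ∘ cong kid))

  -- The vertices in the block of `x′` form a module, by homogeneity and faithfulness. It contains
  -- the distinct `x′` and `y′`, so it is everything, although `x` and `y` lie in different blocks.
  factor-irreducible : Irreducible P κ
  factor-irreducible (β , homogeneous ,
      (x , y , px , py , βx≢βy) , (x′ , y′ , px′ , py′ , x′≢y′ , βx′≡βy′)) =
    βx≢βy (trans (in-block px) (sym (in-block py)))
    where
    member : Ix shape → Bool
    member i = does (β (kid i) ≟ β x′)
    S : Vec Bool _
    S = tabulate member
    from-member : ∀ {i} → lookup S i ≡ true → β (kid i) ≡ β x′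
    from-member {i} e with β (kid i) ≟ β x′ | trans (sym (lookup∘tabulate member i)) e
    ... | yes q | _ = q
    from-nonmember : ∀ {i} → lookup S i ≡ false → β (kid i) ≢ β x′
    from-nonmember {i} e with β (kid i) ≟ β x′ | trans (sym (lookup∘tabulate member i)) e
    ... | no q | _ = q
    to-member : ∀ {i} → β (kid i) ≡ β x′ → lookup S i ≡ true
    to-member {i} e = trans (lookup∘tabulate member i) (dec-true (_ ≟ _) e)
    isModule : Module shape (lookup S)
    isModule i j l i∈ j∈ l∉ = faithful (i≢l ∘ cong (β ∘ kid)) (j≢l ∘ cong (β ∘ kid))
      (trans (sym (color (i≢l ∘ cong (β ∘ kid))))
        (trans (homogeneous _ _ _ _ (kid∈ i) (kid∈ l) (kid∈ j) (kid∈ l)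
                 (trans (from-member i∈) (sym (from-member j∈))) refl i≢l)
               (color (j≢l ∘ cong (β ∘ kid)))))
      where
      i≢l : β (kid i) ≢ β (kid l)
      i≢l e = from-nonmember l∉ (trans (sym e) (from-member i∈))
      j≢l : β (kid j) ≢ β (kid l)
      j≢l e = from-nonmember l∉ (trans (sym e) (from-member j∈))
    in-block : ∀ {z} → P z → β z ≡ β x′
    in-block pz with onto pz | onto px′ | onto py′
    ... | l , refl | i , i≡ | j , j≡ = from-member (modules-trivial shape S isModule i j
      (λ e → x′≢y′ (trans (sym i≡) (trans (cong kid e) j≡)))
      (to-member (cong β i≡)) (to-member (trans (cong β j≡) (sym βx′≡βy′))) l)

  factor-size : HasSize P (suc (suc (arity-2 shape)))
  factor-size = kid , kid-inj , kid∈ , λ _ → onto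

  factor-colors-differ : shape ≢ two → palette true ≢ palette false
  factor-colors-differ ne e = case faithful⇒injective shape {palette} ne faithful e of λ ()

  factor-monochrome : shape ≢ two → ∀ {H} b (σ : Ix shape → Ix shape) → Exhibits shape H b σ →
    MonochromeIso P κ (palette b) _ H (kid ∘ σ)
  factor-monochrome ne b σ (σ-inj , σ-onto , edges) =
    (λ {i} {j} e → σ-inj i j (kid-inj e)) , kid∈ ∘ σ ,
    (λ i j i≢j → let σi≢σj = i≢j ∘ σ-inj i j ; (to , from) = edges i j i≢j in
      (λ e → to (faithful⇒injective shape ne faithful (trans (sym (color σi≢σj)) e))) ,
      (λ h → trans (color σi≢σj) (cong palette (from h)))) ,
    -- The monochrome spans the factor, so no vertex outside it has to be considered.
    λ x px missed → ⊥-elim (let (l , e) = onto px ; (i , e′) = σ-onto l in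
      missed i (trans (cong kid e′) e))

factor-simple : ∀ {C : Set} {k} {P : Fin k → Set} {κ : Fin k → Fin k → C} →
  Factor P κ → Simple P κ
factor-simple F@(record { shape = two }) = inj₁ (factor-size F)
factor-simple F@(record { shape = four }) =
  inj₂ (inj₁ (factor-size F , _ , _ , _ , _ ,
    factor-monochrome F (λ ()) true _ path , factor-monochrome F (λ ()) false _ copath ,
    inj₁ (factor-colors-differ F λ ())))
factor-simple F@(record { shape = five }) =
  inj₂ (inj₂ (factor-size F , _ , _ , _ , _ ,
    factor-monochrome F (λ ()) true _ cycle , factor-monochrome F (λ ()) false _ cocycle ,
    inj₁ (factor-colors-differ F λ ())))

-- Homogeneous partitions of an exact Gallai clique

module Decomposition {C : Set} {n : ℕ} (c : Fin n → Fin n → C)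
  (c-sym : ∀ i j → c i j ≡ c j i) (gallai : IsExactGallai c) where

  open import Data.List.Membership.DecPropositional (_≟_ {n}) using (_∈?_)

  V : Set
  V = Fin n

  -- The triangle condition seen from a vertex with edges coloured `a` and `b` and opposite edge
  -- `e`, according to which two colours agree.
  Tri : C → C → C → Set
  Tri a e b = (a ≡ e × b ≢ e) ⊎ (b ≡ e × a ≢ e) ⊎ (a ≡ b × a ≢ e)

  triangle : ∀ {v x y} → v ≢ x → x ≢ y → v ≢ y → Tri (c v x) (c x y) (c v y)
  triangle v≢x x≢y v≢y with gallai _ _ _ v≢x x≢y v≢y
  ... | inj₁ a≡e        , not-all = inj₁ (a≡e , λ b≡e → not-all (a≡e , sym b≡e))
  ... | inj₂ (inj₁ e≡b) , not-all = inj₂ (inj₁ (sym e≡b , λ a≡e → not-all (a≡e , e≡b)))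
  ... | inj₂ (inj₂ a≡b) , not-all = inj₂ (inj₂ (a≡b , λ a≡e → not-all (a≡e , trans (sym a≡e) a≡b)))

  -- Equality in `C` is not assumed decidable. A triangle nevertheless decides whether a side has
  -- the colour of the base, and all case distinctions on colours rest on this.
  hit-or-miss : ∀ {a e b} → Tri a e b → a ≢ e ⊎ a ≡ e
  hit-or-miss (inj₁ (p , _))        = inj₂ p
  hit-or-miss (inj₂ (inj₁ (_ , p))) = inj₁ p
  hit-or-miss (inj₂ (inj₂ (_ , p))) = inj₁ p

  hit⇒miss : ∀ {a e b} → Tri a e b → a ≡ e → b ≢ e
  hit⇒miss (inj₁ (_ , q))        p = q
  hit⇒miss (inj₂ (inj₁ (_ , q))) p = ⊥-elim (q p)
  hit⇒miss (inj₂ (inj₂ (_ , q))) p = ⊥-elim (q p)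

  misses⇒equal : ∀ {a e b} → Tri a e b → a ≢ e → b ≢ e → a ≡ b
  misses⇒equal (inj₁ (p , _))        a≢e b≢e = ⊥-elim (a≢e p)
  misses⇒equal (inj₂ (inj₁ (p , _))) a≢e b≢e = ⊥-elim (b≢e p)
  misses⇒equal (inj₂ (inj₂ (p , _))) a≢e b≢e = p

  -- A homogeneous partition of the vertices in `xs` with quotient K₂, P₃ or C₅. The labelling is
  -- total on `V`, but only its values on `xs` matter.
  record Decomp (xs : List V) : Set where
    field
      shape    : Shape
      palette  : Bool → C
      faithful : Faithful shape palette
      β        : V → Ix shape
      block    : ∀ i → ∃[ x ] (x ∈ xs × β x ≡ i)
      color    : ∀ {x y} → x ∈ xs → y ∈ xs → β x ≢ β y → c x y ≡ palette (edge shape (β x) (β y))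

  open Decomp

  drop-duplicate : ∀ {v xs} → v ∈ xs → Decomp xs → Decomp (v ∷ xs)
  drop-duplicate {v} {xs} v∈ d = record
    { shape = shape d ; palette = palette d ; faithful = faithful d ; β = β d
    ; block = λ i → let (x , x∈ , e) = block d i in x , there x∈ , e
    ; color = λ x∈ y∈ → color d (strip x∈) (strip y∈) }
    where
    strip : ∀ {x} → x ∈ v ∷ xs → x ∈ xs
    strip (here refl) = v∈
    strip (there x∈)  = x∈

  -- Adding one vertex to a homogeneous partition

  module _ {v : V} {xs : List V} (v∉ : v ∉ xs) where

    apart : ∀ {x} → x ∈ xs → v ≢ x
    apart x∈ refl = v∉ x∈

    -- The common form of all extensions: `v` enters block `j`, which may be empty before, and the
    -- labels of `xs` are kept because `v` is not among them.
    extend : (s : Shape) (palette : Bool → C) → Faithful s palette →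
      (j : Ix s) (β : V → Ix s) →
      (∀ i → i ≡ j ⊎ ∃[ x ] (x ∈ xs × β x ≡ i)) →
      (∀ {x y} → x ∈ xs → y ∈ xs → β x ≢ β y → c x y ≡ palette (edge s (β x) (β y))) →
      (∀ {x} → x ∈ xs → j ≢ β x → c v x ≡ palette (edge s j (β x))) →
      Decomp (v ∷ xs)
    extend s palette faithful j β blocks inner outer = record
      { shape = s ; palette = palette ; faithful = faithful ; β = β′
      ; block = λ i → [ (λ { refl → v , here refl , new })
                      , (λ { (x , x∈ , e) → x , there x∈ , trans (old x∈) e }) ]′ (blocks i)
      ; color = color′ }
      where
      β′ : V → Ix s
      β′ x = if does (v ≟ x) then j else β x
      new : β′ v ≡ j
      new rewrite dec-true (v ≟ v) refl = refl
      old : ∀ {x} → x ∈ xs → β′ x ≡ β x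
      old {x} x∈ rewrite dec-false (v ≟ x) (apart x∈) = refl
      color′ : ∀ {x y} → x ∈ v ∷ xs → y ∈ v ∷ xs → β′ x ≢ β′ y →
        c x y ≡ palette (edge s (β′ x) (β′ y))
      color′ (here refl) (here refl) ne = ⊥-elim (ne refl)
      color′ (here refl) (there y∈)  ne rewrite new | old y∈ = outer y∈ ne
      color′ (there x∈)  (here refl) ne rewrite new | old x∈ =
        trans (c-sym _ _) (trans (outer x∈ (ne ∘ sym)) (cong palette (edge-sym s _ _)))
      color′ (there x∈)  (there y∈)  ne rewrite old x∈ | old y∈ = inner x∈ y∈ ne

    add-outside : ∀ {w z} → w ∈ xs → (∀ {x} → x ∈ xs → c v x ≡ z) → Decomp (v ∷ xs)
    add-outside {w} {z} w∈ uniform = extend two (const z) (λ _ _ _ → refl) zero (const (suc zero))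
      (λ { zero → inj₁ refl ; (suc zero) → inj₂ (w , w∈ , refl) })
      (λ _ _ ne → ⊥-elim (ne refl)) (λ x∈ _ → uniform x∈)

    module _ (d : Decomp xs) where

      -- Every edge to `v` is compared with the one from a representative of block `zero`; vertices
      -- of that block itself take a detour through block `suc zero`.
      add-uniform : (∀ {x y} → x ∈ xs → y ∈ xs → β d x ≢ β d y → c v x ≡ c v y) →
        Decomp (v ∷ xs)
      add-uniform link = add-outside r₀∈ λ {x} x∈ → [ (λ e → link x∈ r₀∈ (subst (β d x ≢_) (sym r₀β) e))
        , (λ e → trans (link x∈ r₁∈ λ e′ → 0≢1 (trans (sym e) (trans e′ r₁β)))
                       (link r₁∈ r₀∈ λ e′ → 0≢1 (trans (sym r₀β) (trans (sym e′) r₁β)))) ]′ (split (β d x))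
        where
        r₀∈ = proj₁ (proj₂ (block d zero))
        r₀β = proj₂ (proj₂ (block d zero))
        r₁∈ = proj₁ (proj₂ (block d (suc zero)))
        r₁β = proj₂ (proj₂ (block d (suc zero)))
        0≢1 : zero {suc (arity-2 (shape d))} ≢ suc zero
        0≢1 ()
        split : (i : Ix (shape d)) → i ≢ zero ⊎ i ≡ zero
        split zero    = inj₂ refl
        split (suc i) = inj₁ λ ()

      add-twin : (j : Ix (shape d)) →
        (∀ {x} → x ∈ xs → j ≢ β d x → c v x ≡ palette d (edge (shape d) j (β d x))) →
        Decomp (v ∷ xs)
      add-twin j = extend (shape d) (palette d) (faithful d) j (β d) (inj₂ ∘ block d) (color d)

      spoke : ∀ {x y} → x ∈ xs → y ∈ xs → β d x ≢ β d y →
        Tri (c v x) (palette d (edge (shape d) (β d x) (β d y))) (c v y)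
      spoke x∈ y∈ ne = subst (λ e → Tri _ e _) (color d x∈ y∈ ne)
        (triangle (apart x∈) (λ { refl → ne refl }) (apart y∈))

    add-pentagon : (d : Decomp xs) → (∀ {a b} → palette d a ≡ palette d b → a ≡ b) →
      (f : Pattern (shape d)) → Pentagon (shape d) f →
      (∀ {x e} → x ∈ xs → Pinned (shape d) f (β d x) (just e) → c v x ≡ palette d e) →
      Decomp (v ∷ xs)
    add-pentagon d@(record { shape = four }) inj f pent pinned =
      extend five (palette d) (λ _ _ → inj) zero (suc ∘ β d)
        (λ { zero → inj₁ refl ; (suc i) → let (x , x∈ , e) = block d i in inj₂ (x , x∈ , cong suc e) })
        (λ {x} {y} x∈ y∈ ne → trans (color d x∈ y∈ (ne ∘ cong suc))
          (cong (palette d) (path-in-pentagon (β d x) (β d y))))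
        (λ {x} x∈ _ → pinned x∈ (pent (β d x)))

    module Prime (d : Decomp xs) (ne : shape d ≢ two) where

      private
        s = shape d

      palette-injective : ∀ {a b} → palette d a ≡ palette d b → a ≡ b
      palette-injective = faithful⇒injective s ne (faithful d)

      HasClass : Class → C → Set
      HasClass nothing  a = ∀ e → a ≢ palette d e
      HasClass (just e) a = a ≡ palette d e

      hit : ∀ {a e} p → HasClass p a → a ≡ palette d e → p ≡ just e
      hit nothing  h q = ⊥-elim (h _ q)
      hit (just _) h q = cong just (palette-injective (trans (sym h) q))

      miss : ∀ {a e} p → HasClass p a → a ≢ palette d e → p ≢ just e
      miss _ h ne refl = ne h

      class-unique : ∀ {a} p q → HasClass p a → HasClass q a → p ≡ q
      class-unique p        (just _) h k = hit p h k
      class-unique nothing  nothing  h k = refl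
      class-unique (just _) nothing  h k = ⊥-elim (k _ h)

      fits : ∀ {a b e} p q → HasClass p a → HasClass q b → Tri a (palette d e) b → Fits e p q
      fits p q h k (inj₁ (x , y))        = inj₁ (hit p h x , miss q k y)
      fits p q h k (inj₂ (inj₁ (x , y))) = inj₂ (inj₁ (hit q k x , miss p h y))
      fits p q h k (inj₂ (inj₂ (refl , y))) = inj₂ (inj₂ (class-unique p q h k , miss p h y))

      -- By `edge-meets-both`, `x` has an edge of each palette colour to another block; the triangle
      -- of this edge with `v` decides whether `c v x` is that colour.
      classify : ∀ {x} → x ∈ xs → ∃[ p ] HasClass p (c v x)
      classify {x} x∈ with decide true | decide false
        where
        decide : ∀ e → c v x ≢ palette d e ⊎ c v x ≡ palette d e
        decide e with edge-meets-both s ne (β d x) e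
        ... | j , i≢j , refl with block d j
        ...   | y , y∈ , refl = hit-or-miss (spoke d x∈ y∈ i≢j)
      ... | inj₂ p | _      = just true , p
      ... | inj₁ p | inj₂ q = just false , q
      ... | inj₁ p | inj₁ q = nothing , λ { true → p ; false → q }

      reps : Ix s → V
      reps i = proj₁ (block d i)

      reps∈ : ∀ i → reps i ∈ xs
      reps∈ i = proj₁ (proj₂ (block d i))

      β-reps : ∀ i → β d (reps i) ≡ i
      β-reps i = proj₂ (proj₂ (block d i))

      class-of-rep : ∀ i → ∃[ p ] HasClass p (c v (reps i))
      class-of-rep i = classify (reps∈ i)

      classes : Pattern s
      classes = tabulate (proj₁ ∘ class-of-rep)

      class-rep : ∀ i → HasClass (lookup classes i) (c v (reps i))
      class-rep i = subst (λ p → HasClass p (c v (reps i)))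
        (sym (lookup∘tabulate (proj₁ ∘ class-of-rep) i)) (proj₂ (class-of-rep i))

      fits-rep : ∀ {x} (x∈ : x ∈ xs) p → HasClass p (c v x) → ∀ i → β d x ≢ i →
        Fits (edge s (β d x) i) p (lookup classes i)
      fits-rep {x} x∈ p h i ne = fits p (lookup classes i) h (class-rep i)
        (subst (λ j → Tri (c v x) (palette d (edge s (β d x) j)) (c v (reps i))) (β-reps i)
          (spoke d x∈ (reps∈ i) (subst (β d x ≢_) (sym (β-reps i)) ne)))

      valid : Valid s classes
      valid i j ne = subst (λ k → Fits (edge s k j) (lookup classes i) (lookup classes j)) (β-reps i)
        (fits-rep (reps∈ i) (lookup classes i) (class-rep i) j (subst (_≢ j) (sym (β-reps i)) ne))

      pinned : ∀ {x p} → x ∈ xs → Pinned s classes (β d x) p → HasClass p (c v x)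
      pinned {x} x∈ (refl , rigid) with classify x∈
      ... | q , h = subst (λ q → HasClass q (c v x)) (rigid q (fits-rep x∈ q h)) h

      add-to-prime : Decomp (v ∷ xs)
      add-to-prime with valid⇒position s ne classes valid
      ... | inj₁ out = add-uniform d λ {x} {y} x∈ y∈ x≁y → misses⇒equal (spoke d x∈ y∈ x≁y)
              (pinned {p = nothing} x∈ (out (β d x)) _) (pinned {p = nothing} y∈ (out (β d y)) _)
      ... | inj₂ (inj₁ (j , tw)) = add-twin d j λ x∈ j≢ → pinned {p = just _} x∈ (tw _ j≢)
      ... | inj₂ (inj₂ pent) =
              add-pentagon d palette-injective classes pent (λ {x} {e} → pinned {x} {just e})

    -- The indices are places on the new path, where `zero` is reserved for `v`. A hit is expressed
    -- by agreement with the colour at `p`.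
    data Kind {k} (β : V → Fin k) (p : V) (w : V) : Ix four → Set where
      near-hit  : β w ≡ β p → c v w ≡ c v p → Kind β p w (suc zero)
      far       : β w ≢ β p → Kind β p w (suc (suc zero))
      near-miss : β w ≡ β p → c v w ≢ c v p → Kind β p w (suc (suc (suc zero)))

    module Pair (pal : Bool → C) (β₂ : V → Ix two) (block₂ : ∀ i → ∃[ x ] (x ∈ xs × β₂ x ≡ i))
      (color₂ : ∀ {x y} → x ∈ xs → y ∈ xs → β₂ x ≢ β₂ y → c x y ≡ pal true) where

      private
        d : Decomp xs
        d = record { shape = two ; palette = pal ; faithful = λ _ _ _ → refl
                   ; β = β₂ ; block = block₂ ; color = color₂ }

      across : ∀ x → ∃[ y ] (y ∈ xs × β₂ x ≢ β₂ y)
      across x with another (β₂ x)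
      ... | j , ne with block₂ j
      ...   | y , y∈ , refl = y , y∈ , ne ∘ sym

      hit? : ∀ {x} → x ∈ xs → c v x ≢ pal true ⊎ c v x ≡ pal true
      hit? {x} x∈ with across x
      ... | y , y∈ , ne = hit-or-miss (spoke d x∈ y∈ ne)

      -- The block of p and q splits according to the colours towards v; together with v and
      -- the other block this gives the path v, hits, other block, misses.
      module Split {p q : V} (p∈ : p ∈ xs) (q∈ : q ∈ xs) (q~p : β₂ q ≡ β₂ p)
        (p-hit : c v p ≡ pal true) (q-miss : c v q ≢ pal true) where

        far-miss : ∀ {w} → w ∈ xs → β₂ w ≢ β₂ p → c v w ≢ pal true
        far-miss w∈ ne = hit⇒miss (spoke d p∈ w∈ (ne ∘ sym)) p-hit

        far-color : ∀ {w} → w ∈ xs → β₂ w ≢ β₂ p → c v w ≡ c v q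
        far-color {w} w∈ ne =
          misses⇒equal (spoke d w∈ q∈ (λ e → ne (trans e q~p))) (far-miss w∈ ne) q-miss

        -- The comparison with `q` passes through a vertex `r` of the other block: the edges from
        -- `v` to `w`, `r` and `q` all miss.
        near-color : ∀ {w} → w ∈ xs → β₂ w ≡ β₂ p → c v w ≢ pal true → c v w ≡ c v q
        near-color {w} w∈ w~p w-miss with across w
        ... | r , r∈ , ne =
          trans (misses⇒equal (spoke d w∈ r∈ ne) w-miss (far-miss r∈ r≁p)) (far-color r∈ r≁p)
          where
          r≁p : β₂ r ≢ β₂ p
          r≁p e = ne (trans w~p (sym e))

        -- The triangle with `v` leaves only the colours of its two sides. If `x` and `y` were
        -- joined by `pal true`, they would form a monochromatic triangle with any `r` in the other
        -- block.
        hit-miss-color : ∀ {x y} → x ∈ xs → y ∈ xs → β₂ x ≡ β₂ p → β₂ y ≡ β₂ p →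
          c v x ≡ pal true → c v y ≢ pal true → c x y ≡ c v q
        hit-miss-color {x} {y} x∈ y∈ x~p y~p x-hit y-miss
          with triangle (apart x∈) x≢y (apart y∈)
          where
          x≢y : x ≢ y
          x≢y refl = y-miss x-hit
        ... | inj₂ (inj₁ (e , _)) = trans (sym e) (near-color y∈ y~p y-miss)
        ... | inj₂ (inj₂ (e , _)) = ⊥-elim (y-miss (trans (sym e) x-hit))
        ... | inj₁ (e , _) with across x
        ...   | r , r∈ , ne = ⊥-elim (hit⇒miss
                  (triangle (λ { refl → ne refl }) (λ { refl → y-miss x-hit })
                            (λ { refl → ne (trans x~p (sym y~p)) }))
                  (trans (color₂ r∈ x∈ (ne ∘ sym)) through)
                  (trans (color₂ r∈ y∈ (λ e → ne (trans x~p (trans (sym y~p) (sym e))))) through))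
          where
          through : pal true ≡ c x y
          through = trans (sym x-hit) e

        KindOf : V → Ix four → Set
        KindOf = Kind β₂ p

        kind : ∀ {w} → w ∈ xs → ∃ (KindOf w)
        kind {w} w∈ with β₂ w ≟ β₂ p | hit? w∈
        ... | no ne | _      = _ , far ne
        ... | yes e | inj₁ m = _ , near-miss e (λ h → m (trans h p-hit))
        ... | yes e | inj₂ h = _ , near-hit e (trans h (sym p-hit))

        total-kind : ∀ w → ∃[ i ] (w ∈ xs → KindOf w i)
        total-kind w with w ∈? xs
        -- An arbitrary label, as no condition is imposed outside `xs`.
        ... | no  w∉ = zero , ⊥-elim ∘ w∉
        ... | yes w∈ = proj₁ (kind w∈) , const (proj₂ (kind w∈))

        β₄ : V → Ix four
        β₄ w = proj₁ (total-kind w)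

        kind-unique : ∀ {w i j} → KindOf w i → KindOf w j → i ≡ j
        kind-unique (near-hit _ _)  (near-hit _ _)  = refl
        kind-unique (near-hit e _)  (far ne)        = ⊥-elim (ne e)
        kind-unique (near-hit _ h)  (near-miss _ m) = ⊥-elim (m h)
        kind-unique (far ne)        (near-hit e _)  = ⊥-elim (ne e)
        kind-unique (far _)         (far _)         = refl
        kind-unique (far ne)        (near-miss e _) = ⊥-elim (ne e)
        kind-unique (near-miss _ m) (near-hit _ h)  = ⊥-elim (m h)
        kind-unique (near-miss e _) (far ne)        = ⊥-elim (ne e)
        kind-unique (near-miss _ _) (near-miss _ _) = refl

        pal₄ : Bool → C
        pal₄ true  = pal true
        pal₄ false = c v q

        pal₄-injective : ∀ {a b} → pal₄ a ≡ pal₄ b → a ≡ b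
        pal₄-injective {true}  {true}  _ = refl
        pal₄-injective {true}  {false} e = ⊥-elim (q-miss (sym e))
        pal₄-injective {false} {true}  e = ⊥-elim (q-miss e)
        pal₄-injective {false} {false} _ = refl

        kind-color : ∀ {x y i j} → x ∈ xs → y ∈ xs → KindOf x i → KindOf y j → i ≢ j →
          c x y ≡ pal₄ (edge four i j)
        kind-color x∈ y∈ (near-hit _ _)  (near-hit _ _)   ne = ⊥-elim (ne refl)
        kind-color x∈ y∈ (near-hit e _)  (far f)          ne = color₂ x∈ y∈ λ g → f (trans (sym g) e)
        kind-color x∈ y∈ (near-hit e h)  (near-miss e′ m) ne =
          hit-miss-color x∈ y∈ e e′ (trans h p-hit) (λ g → m (trans g (sym p-hit)))
        kind-color x∈ y∈ (far f)         (near-hit e _)   ne = color₂ x∈ y∈ λ g → f (trans g e)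
        kind-color x∈ y∈ (far _)         (far _)          ne = ⊥-elim (ne refl)
        kind-color x∈ y∈ (far f)         (near-miss e _)  ne = color₂ x∈ y∈ λ g → f (trans g e)
        kind-color x∈ y∈ (near-miss e m) (near-hit e′ h)  ne = trans (c-sym _ _)
          (hit-miss-color y∈ x∈ e′ e (trans h p-hit) (λ g → m (trans g (sym p-hit))))
        kind-color x∈ y∈ (near-miss e _) (far f)          ne = color₂ x∈ y∈ λ g → f (trans (sym g) e)
        kind-color x∈ y∈ (near-miss _ _) (near-miss _ _)  ne = ⊥-elim (ne refl)

        spoke-color : ∀ {x i} → x ∈ xs → KindOf x i → c v x ≡ pal₄ (edge four zero i)
        spoke-color x∈ (near-hit _ h)  = trans h p-hit
        spoke-color x∈ (far f)         = far-color x∈ f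
        spoke-color x∈ (near-miss e m) = near-color x∈ e (λ g → m (trans g (sym p-hit)))

        blocks₄ : ∀ i → i ≡ zero ⊎ ∃[ x ] (x ∈ xs × β₄ x ≡ i)
        blocks₄ zero = inj₁ refl
        blocks₄ (suc zero) =
          inj₂ (p , p∈ , kind-unique (proj₂ (total-kind p) p∈) (near-hit refl refl))
        blocks₄ (suc (suc zero)) with across p
        ... | r , r∈ , ne = inj₂ (r , r∈ , kind-unique (proj₂ (total-kind r) r∈) (far (ne ∘ sym)))
        blocks₄ (suc (suc (suc zero))) =
          inj₂ (q , q∈ , kind-unique (proj₂ (total-kind q) q∈)
            (near-miss q~p (λ e → q-miss (trans e p-hit))))

        add-splitting : Decomp (v ∷ xs)
        add-splitting = extend four pal₄ (λ _ _ → pal₄-injective) zero β₄ blocks₄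
          (λ {x} {y} x∈ y∈ → kind-color x∈ y∈ (proj₂ (total-kind x) x∈) (proj₂ (total-kind y) y∈))
          (λ {x} x∈ _ → spoke-color x∈ (proj₂ (total-kind x) x∈))

      same-block : ∀ (i j k : Ix two) → j ≢ i → j ≢ k → k ≡ i
      same-block zero       zero       k          ne _   = ⊥-elim (ne refl)
      same-block zero       (suc zero) zero       _  _   = refl
      same-block zero       (suc zero) (suc zero) _  ne′ = ⊥-elim (ne′ refl)
      same-block (suc zero) zero       zero       _  ne′ = ⊥-elim (ne′ refl)
      same-block (suc zero) zero       (suc zero) _  _   = refl
      same-block (suc zero) (suc zero) k          ne _   = ⊥-elim (ne refl)

      -- If no edge from `v` has the colour between the blocks, all of them agree. If some vertex
      -- `p` is hit and its whole block with it, `v` is a twin of the opposite block `j`. Otherwise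
      -- the block of `p` splits.
      add-to-pair : Decomp (v ∷ xs)
      add-to-pair with search {Q = λ x → c v x ≡ pal true} xs hit?
      ... | inj₁ misses = add-uniform d λ x∈ y∈ ne →
              misses⇒equal (spoke d x∈ y∈ ne) (misses x∈) (misses y∈)
      ... | inj₂ (p , p∈ , p-hit) with search xs block-hit?
        where
        block-hit? : ∀ {w} → w ∈ xs →
          (β₂ w ≡ β₂ p → c v w ≡ pal true) ⊎ (β₂ w ≡ β₂ p × c v w ≢ pal true)
        block-hit? {w} w∈ with β₂ w ≟ β₂ p | hit? w∈
        ... | no ne | _      = inj₁ (⊥-elim ∘ ne)
        ... | yes e | inj₁ m = inj₂ (e , m)
        ... | yes e | inj₂ h = inj₁ (const h)
      ...   | inj₂ (q , q∈ , q~p , q-miss) = Split.add-splitting p∈ q∈ q~p p-hit q-miss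
      ...   | inj₁ hits = add-twin d j λ {x} x∈ ne → hits x∈ (same-block (β₂ p) j (β₂ x) j≢ ne)
        where
        j = proj₁ (another (β₂ p))
        j≢ = proj₂ (another (β₂ p))

    add : Decomp xs → Decomp (v ∷ xs)
    add d@(record { shape = two })  = Pair.add-to-pair (palette d) (β d) (block d) (color d)
    add d@(record { shape = four }) = Prime.add-to-prime d λ ()
    add d@(record { shape = five }) = Prime.add-to-prime d λ ()

  -- Lists may repeat vertices, so a one-vertex clique shows up as a list with all entries equal.
  decompose : ∀ x xs → (∀ {y} → y ∈ x ∷ xs → y ≡ x) ⊎ Decomp (x ∷ xs)
  decompose x [] = inj₁ λ { (here e) → e }
  decompose x (w ∷ ws) with x ∈? (w ∷ ws) | decompose w ws
  ... | yes x∈ | inj₂ d   = inj₂ (drop-duplicate x∈ d)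
  ... | no  x∉ | inj₂ d   = inj₂ (add x∉ d)
  ... | no  x∉ | inj₁ all = inj₂ (add-outside x∉ (here refl) λ y∈ → cong (c x) (all y∈))
  ... | yes x∈ | inj₁ all = inj₁ λ
          { (here e) → e ; (there y∈) → trans (all y∈) (sym (all x∈)) }

  -- Iterating the decomposition

  part : ∀ {xs} (d : Decomp xs) → Ix (shape d) → List V
  part {xs} d i = filter (λ x → β d x ≟ i) xs

  -- A representative of another block is filtered out; this makes `grow` terminate.
  part-smaller : ∀ {xs} (d : Decomp xs) i → length (part d i) ℕ.< length xs
  part-smaller {xs} d i with another i
  ... | j , j≢i with block d j
  ...   | x , x∈ , refl = filter-notAll (λ x → β d x ≟ i) xs (lose x∈ j≢i)

  data Tree (xs : List V) : Set where
    leaf : (x : V) → x ∈ xs → (∀ {y} → y ∈ xs → y ≡ x) → Tree xs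
    node : (d : Decomp xs) → (∀ i → Tree (part d i)) → Tree xs

  grow : ∀ {x} xs → Acc ℕ._<_ (length xs) → x ∈ xs → Tree xs
  grow (x ∷ xs) (acc smaller) _ with decompose x xs
  ... | inj₁ all = leaf x (here refl) all
  ... | inj₂ d   = node d λ i → let (y , y∈ , e) = block d i in
          grow (part d i) (smaller (part-smaller d i)) (∈-filter⁺ (λ x → β d x ≟ i) y∈ e)

  -- Tree positions and their order

  data Pos : ∀ {xs} → Tree xs → Set where
    here  : ∀ {xs} {t : Tree xs} → Pos t
    there : ∀ {xs} {d : Decomp xs} {ch : ∀ i → Tree (part d i)} (i : Ix (shape d)) →
      Pos (ch i) → Pos (node d ch)

  -- Positions are paths from the root, and `p ⊑ q` says that `q` is an initial segment of `p`; the
  -- root is the greatest element.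
  data _⊑_ : ∀ {xs} {t : Tree xs} → Pos t → Pos t → Set where
    below : ∀ {xs} {t : Tree xs} {p : Pos t} → p ⊑ here
    under : ∀ {xs} {d : Decomp xs} {ch : ∀ i → Tree (part d i)} {i} {p q : Pos (ch i)} →
      p ⊑ q → there {d = d} {ch} i p ⊑ there i q

  data Child : ∀ {xs} {t : Tree xs} → Pos t → Pos t → Set where
    top   : ∀ {xs} {d : Decomp xs} {ch : ∀ i → Tree (part d i)} {i} →
      Child {t = node d ch} here (there i here)
    inner : ∀ {xs} {d : Decomp xs} {ch : ∀ i → Tree (part d i)} {i} {p q : Pos (ch i)} →
      Child p q → Child {t = node d ch} (there i p) (there i q)

  there-injective : ∀ {xs} {d : Decomp xs} {ch : ∀ i → Tree (part d i)} {i} {p q : Pos (ch i)} →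
    there {d = d} {ch} i p ≡ there i q → p ≡ q
  there-injective refl = refl

  there-index : ∀ {xs} {d : Decomp xs} {ch : ∀ i → Tree (part d i)} {i j}
    {p : Pos (ch i)} {q : Pos (ch j)} → there {d = d} {ch} i p ≡ there j q → i ≡ j
  there-index refl = refl

  ⊑-refl : ∀ {xs} {t : Tree xs} (p : Pos t) → p ⊑ p
  ⊑-refl here        = below
  ⊑-refl (there i p) = under (⊑-refl p)

  ⊑-trans : ∀ {xs} {t : Tree xs} {p q r : Pos t} → p ⊑ q → q ⊑ r → p ⊑ r
  ⊑-trans _         below     = below
  ⊑-trans (under a) (under b) = under (⊑-trans a b)

  ⊑-antisym : ∀ {xs} {t : Tree xs} {p q : Pos t} → p ⊑ q → q ⊑ p → p ≡ q
  ⊑-antisym below     below     = refl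
  ⊑-antisym (under a) (under b) = cong (there _) (⊑-antisym a b)

  ⊑-total-above : ∀ {xs} {t : Tree xs} {z p q : Pos t} → z ⊑ p → z ⊑ q → p ⊑ q ⊎ q ⊑ p
  ⊑-total-above _     below = inj₁ below
  ⊑-total-above below _     = inj₂ below
  ⊑-total-above (under a) (under b) with ⊑-total-above a b
  ... | inj₁ p⊑q = inj₁ (under p⊑q)
  ... | inj₂ q⊑p = inj₂ (under q⊑p)

  child-⊑ : ∀ {xs} {t : Tree xs} {p q : Pos t} → Child p q → q ⊑ p
  child-⊑ top       = below
  child-⊑ (inner a) = under (child-⊑ a)

  child-≢ : ∀ {xs} {t : Tree xs} {p q : Pos t} → Child p q → q ≢ p
  child-≢ (inner a) e = child-≢ a (there-injective e)

  child-covered : ∀ {xs} {t : Tree xs} {p q u : Pos t} → Child p q →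
    q ⊑ u → u ⊑ p → q ≡ u ⊎ u ≡ p
  child-covered top       below         below     = inj₂ refl
  child-covered top       (under below) below     = inj₁ refl
  child-covered (inner a) (under b)     (under e) with child-covered a b e
  ... | inj₁ refl = inj₁ refl
  ... | inj₂ refl = inj₂ refl

  here? : ∀ {xs} {t : Tree xs} (p : Pos t) → p ≡ here ⊎ p ≢ here
  here? here        = inj₁ refl
  here? (there _ _) = inj₂ λ ()

  -- If a position below the root is not the root of an immediate subtree, then the root of that
  -- subtree lies strictly between.
  covered-child : ∀ {xs} {t : Tree xs} {p q : Pos t} → q ⊑ p → q ≢ p →
    (∀ u → q ⊑ u → q ≢ u → u ⊑ p → u ≢ p → ⊥) → Child p q
  covered-child {q = here} below ne _ = ⊥-elim (ne refl)
  covered-child {q = there i r} below _ cover with here? r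
  ... | inj₁ refl = top
  ... | inj₂ ne   =
    ⊥-elim (cover (there i here) (under below) (ne ∘ there-injective) below (λ ()))
  covered-child (under a) ne cover = inner (covered-child a (ne ∘ cong (there _))
    λ u a′ ne₁ b ne₂ → cover (there _ u) (under a′) (ne₁ ∘ there-injective)
                             (under b) (ne₂ ∘ there-injective))

  pos-finite : ∀ {xs} (t : Tree xs) → ∃[ m ] (Pos t ↔ Fin m)
  pos-finite (leaf _ _ _) = 1 , ↔-trans
    (mk↔ₛ′ (const tt) (const here) (λ _ → refl) (λ { here → refl })) (↔-sym 1↔⊤)
  pos-finite (node d ch) with Σ-finite (λ i → pos-finite (ch i))
  ... | m , iso = suc m , ↔-trans
    (mk↔ₛ′ (λ { here → inj₁ tt ; (there i p) → inj₂ (i , p) })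
           (λ { (inj₁ tt) → here ; (inj₂ (i , p)) → there i p })
           (λ { (inj₁ tt) → refl ; (inj₂ _) → refl })
           (λ { here → refl ; (there _ _) → refl }))
    (↔-trans (↔-sym 1↔⊤ ⊎-↔ iso) (↔-sym +↔⊎))

  module Colored (default : C) where

    -- The colour is read off where the two paths diverge. The default arises only when one path is
    -- an initial segment of the other, hence never for siblings.
    color-at : ∀ {xs} {t : Tree xs} → Pos t → Pos t → C
    color-at here _ = default
    color-at (there _ _) here = default
    color-at (there {d = d} i p) (there j q) with i ≟ j
    ... | yes refl = color-at p q
    ... | no _     = palette d (edge (shape d) i j)

    color-at-inner : ∀ {xs} (d : Decomp xs) (ch : ∀ i → Tree (part d i)) {i} (p q : Pos (ch i)) →
      color-at {t = node d ch} (there i p) (there i q) ≡ color-at p q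
    color-at-inner d ch {i} p q with i ≟ i
    ... | yes refl = refl
    ... | no ne    = ⊥-elim (ne refl)

    color-at-outer : ∀ {xs} {d : Decomp xs} {ch : ∀ i → Tree (part d i)} {i j}
      {p : Pos (ch i)} {q : Pos (ch j)} → i ≢ j →
      color-at {t = node d ch} (there i p) (there j q) ≡ palette d (edge (shape d) i j)
    color-at-outer {i = i} {j} ne with i ≟ j
    ... | yes e = ⊥-elim (ne e)
    ... | no _  = refl

    color-at-sym : ∀ {xs} {t : Tree xs} (p q : Pos t) → color-at p q ≡ color-at q p
    color-at-sym here        here        = refl
    color-at-sym here        (there _ _) = refl
    color-at-sym (there _ _) here        = refl
    color-at-sym (there {d = d} {ch} i p) (there j q) with i ≟ j
    ... | yes refl = trans (color-at-sym p q) (sym (color-at-inner d ch q p))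
    ... | no ne    = trans (cong (palette d) (edge-sym (shape d) i j)) (sym (color-at-outer (ne ∘ sym)))

    -- Leaves

    data At : ∀ {xs} (t : Tree xs) → V → Pos t → Set where
      at-leaf : ∀ {xs x} {x∈ : x ∈ xs} {all : ∀ {y} → y ∈ xs → y ≡ x} →
        At (leaf x x∈ all) x here
      at-node : ∀ {xs x} {d : Decomp xs} {ch : ∀ i → Tree (part d i)} {p : Pos (ch (β d x))} →
        At (ch (β d x)) x p → At (node d ch) x (there (β d x) p)

    ∈-part : ∀ {xs x} (d : Decomp xs) → x ∈ xs → x ∈ part d (β d x)
    ∈-part d x∈ = ∈-filter⁺ (λ y → β d y ≟ _) x∈ refl

    part-∈ : ∀ {xs x} (d : Decomp xs) {i} → x ∈ part d i → x ∈ xs × β d x ≡ i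
    part-∈ d {i} = ∈-filter⁻ (λ y → β d y ≟ i)

    locate : ∀ {xs} (t : Tree xs) {x} → x ∈ xs → ∃ (At t x)
    locate (leaf x x∈ all) y∈ with all y∈
    ... | refl = here , at-leaf
    locate (node d ch) x∈ with locate (ch _) (∈-part d x∈)
    ... | p , at = there _ p , at-node at

    at-functional : ∀ {xs} {t : Tree xs} {x p q} → At t x p → At t x q → p ≡ q
    at-functional at-leaf     at-leaf     = refl
    at-functional (at-node a) (at-node b) = cong (there _) (at-functional a b)

    at-injective : ∀ {xs} {t : Tree xs} {x y p q} → At t x p → At t y q → p ≡ q → x ≡ y
    at-injective at-leaf at-leaf _ = refl
    -- The block indices are `β d x` and `β d y`; `go` replaces them by variables so that their
    -- equality can be matched.
    at-injective (at-node {ch = ch} a) (at-node b) e = go a b e (there-index e)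
      where
      go : ∀ {i j x y} {p : Pos (ch i)} {q : Pos (ch j)} → At (ch i) x p → At (ch j) y q →
        there {ch = ch} i p ≡ there j q → i ≡ j → x ≡ y
      go a b e refl = at-injective a b (there-injective e)

    at-∈ : ∀ {xs} {t : Tree xs} {x p} → At t x p → x ∈ xs
    at-∈ (at-leaf {x∈ = x∈})   = x∈
    at-∈ (at-node {d = d} at) = proj₁ (part-∈ d (at-∈ at))

    at-childless : ∀ {xs} {t : Tree xs} {x p q} → At t x p → ¬ Child p q
    at-childless at-leaf     ()
    at-childless (at-node a) (inner k) = at-childless a k

    childless-at : ∀ {xs} {t : Tree xs} (p : Pos t) → (∀ q → ¬ Child p q) → ∃[ x ] At t x p
    childless-at {t = leaf x _ _} here none = x , at-leaf
    childless-at {t = node d ch}  here none = ⊥-elim (none _ (top {i = zero}))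
    childless-at {t = node d ch} (there i p) none
      with childless-at p (λ q k → none (there i q) (inner k))
    ... | x , at = x , at-part at (proj₂ (part-∈ d (at-∈ at)))
      where
      at-part : ∀ {i p} → At (ch i) x p → β d x ≡ i → At (node d ch) x (there i p)
      at-part at refl = at-node at

    -- Colours of siblings

    record Branch {xs} {t : Tree xs} (p : Pos t) (z : C) : Set where
      constructor branch
      field
        {left right} : Pos t
        left-child   : Child p left
        right-child  : Child p right
        left≢right   : left ≢ right
        branch-color : color-at left right ≡ z

    open Branch

    lift-branch : ∀ {xs} {d : Decomp xs} {ch : ∀ i → Tree (part d i)} {i} {p : Pos (ch i)} {z} →
      Branch p z → Branch (there {d = d} {ch} i p) z
    lift-branch {d = d} {ch} (branch {p} {q} k l ne e) =
      branch (inner k) (inner l) (ne ∘ there-injective) (trans (color-at-inner d ch p q) e)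

    lower-branch : ∀ {xs} {d : Decomp xs} {ch : ∀ i → Tree (part d i)} {i} {p : Pos (ch i)} {z} →
      Branch (there {d = d} {ch} i p) z → Branch p z
    lower-branch {d = d} {ch} (branch (inner {q = p} k) (inner {q = q} l) ne e) =
      branch k l (ne ∘ cong (there _)) (trans (sym (color-at-inner d ch p q)) e)

    root-branch : ∀ {xs} {d : Decomp xs} {ch : ∀ i → Tree (part d i)} {i j} → i ≢ j →
      Branch {t = node d ch} here (palette d (edge (shape d) i j))
    root-branch ne = branch top top (ne ∘ there-index) (color-at-outer ne)

    root-branch-color : ∀ {xs} {d : Decomp xs} {ch : ∀ i → Tree (part d i)} {z} →
      Branch {t = node d ch} here z → ∃[ i ] ∃[ j ] (i ≢ j × palette d (edge (shape d) i j) ≡ z)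
    root-branch-color {d = d} (branch (top {i = i}) (top {i = j}) ne e) =
      i , j , i≢j , trans (sym (color-at-outer {p = here} {here} i≢j)) e
      where
      i≢j : i ≢ j
      i≢j refl = ne refl

    -- Descends while both vertices lie in the same block; where they part, the colour of their edge
    -- is the palette colour of the two blocks.
    separate : ∀ {xs} {t : Tree xs} {x y p q} → At t x p → At t y q → x ≢ y →
      ∃[ r ] Σ (Branch r (c x y)) λ b → p ⊑ left b × q ⊑ right b
    separate at-leaf at-leaf ne = ⊥-elim (ne refl)
    separate (at-node {x = x} {d} {ch} a) (at-node {x = y} b) ne with β d x ≟ β d y
    ... | no i≢j = here , subst (λ z → Σ (Branch here z) λ b → _ ⊑ left b × _ ⊑ right b)
            (sym (color d (proj₁ (part-∈ d (at-∈ a))) (proj₁ (part-∈ d (at-∈ b))) i≢j))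
            (root-branch i≢j , under below , under below)
    ... | yes e = go a b e
      where
      go : ∀ {i j p q} → At (ch i) x p → At (ch j) y q → i ≡ j →
        ∃[ r ] Σ (Branch {t = node d ch} r (c x y)) λ b → there i p ⊑ left b × there j q ⊑ right b
      go a b refl with separate a b ne
      ... | r , s , u , v = there _ r , lift-branch s , under u , under v

    -- Representatives of two blocks realise the colour of a sibling edge in the clique itself,
    -- where the triangle condition can be applied.
    realize : ∀ {xs} {t : Tree xs} {p : Pos t} {z} → Branch p z →
      ∃[ x ] ∃[ y ] (x ∈ xs × y ∈ xs × x ≢ y × c x y ≡ z)
    realize {t = node d ch} {here} b with root-branch-color b
    ... | i , j , i≢j , refl with block d i | block d j
    ...   | x , x∈ , refl | y , y∈ , refl =
      x , y , x∈ , y∈ , (λ { refl → i≢j refl }) , color d x∈ y∈ i≢j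
    realize {t = node d ch} {there i p} b with realize (lower-branch b)
    ... | x , y , x∈ , y∈ , rest = x , y , proj₁ (part-∈ d x∈) , proj₁ (part-∈ d y∈) , rest

    -- An edge below the child i whose colour occurs at the root forms a monochromatic
    -- triangle with any vertex of a block that is joined to i by that colour.
    layers : ∀ {xs} {t : Tree xs} {p q : Pos t} {z} → p ⊑ q → p ≢ q → Branch p z → ¬ Branch q z
    layers {p = here} below ne _ _ = ne refl
    layers {t = node d ch} {there i p} below _ b b₀
      with realize (lower-branch b) | root-branch-color b₀
    ... | x , y , x∈ , y∈ , x≢y , xy | _ , _ , j≢k , refl with edge-meets-all (shape d) j≢k i
    ...   | l , i≢l , e with block d l | part-∈ d x∈ | part-∈ d y∈
    ...     | w , w∈ , refl | x∈′ , x~i | y∈′ , y~i =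
      proj₂ (gallai x y w x≢y (λ { refl → i≢l (sym y~i) }) λ { refl → i≢l (sym x~i) })
        (trans xy (sym (to-w y∈′ y~i)) , trans (to-w y∈′ y~i) (sym (to-w x∈′ x~i)))
      where
      to-w : ∀ {u} → u ∈ _ → β d u ≡ i → c u w ≡ palette d _
      to-w u∈ refl = trans (color d u∈ w∈ i≢l) (cong (palette d) e)
    layers (under a) ne b b′ = layers a (ne ∘ cong (there _)) (lower-branch b) (lower-branch b′)

    -- Nodes as an initial segment of ℕ

    factor-at : ∀ {xs} {t : Tree xs} (p : Pos t) → (∀ q → ¬ Child p q) ⊎ Factor (Child p) color-at
    factor-at {t = leaf _ _ _} here = inj₁ λ _ ()
    factor-at {t = node d ch}  here = inj₂ record
      { shape = shape d ; palette = palette d ; faithful = faithful d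
      ; kid = λ i → there i here ; kid-inj = there-index ; kid∈ = λ _ → top
      ; onto = λ { (top {i = i}) → i , refl } ; color = color-at-outer }
    factor-at {t = node d ch} (there i p) with factor-at p
    ... | inj₁ none = inj₁ λ { _ (inner k) → none _ k }
    ... | inj₂ F = inj₂ (map-factor (there i) there-injective inner
                          (λ { (inner k) → _ , k , refl }) (color-at-inner d ch) F)

    module _ (t : Tree (allFin n)) where

      private
        m = proj₁ (pos-finite t)
        iso = proj₂ (pos-finite t)

        to : Pos t → Fin m
        to = Inverse.to iso

        from : Fin m → Pos t
        from = Inverse.from iso

        from-to : ∀ p → from (to p) ≡ p
        from-to = Inverse.strictlyInverseʳ iso

        to-from : ∀ a → to (from a) ≡ a
        to-from = Inverse.strictlyInverseˡ iso

        to-injective : ∀ {p q} → to p ≡ to q → p ≡ q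
        to-injective e = trans (sym (from-to _)) (trans (cong from e) (from-to _))

        from-injective : ∀ {a b} → from a ≡ from b → a ≡ b
        from-injective e = trans (sym (to-from _)) (trans (cong to e) (to-from _))

        _≼_ : Fin m → Fin m → Set
        a ≼ b = from a ⊑ from b

        κ : Fin m → Fin m → C
        κ a b = color-at (from a) (from b)

        ≼-isPartialOrder : IsPartialOrder _≡_ _≼_
        ≼-isPartialOrder = record
          { isPreorder = record
            { isEquivalence = isEquivalence
            ; reflexive = λ { refl → ⊑-refl _ }
            ; trans = ⊑-trans }
          ; antisym = λ p q → from-injective (⊑-antisym p q) }

        root : Fin m
        root = to here

        below-root : ∀ a → a ≼ root
        below-root a = subst (from a ⊑_) (sym (from-to here)) below

        ≼-isTree : IsTree _≼_
        ≼-isTree = ≼-isPartialOrder , λ a b (a⋠b , b⋠a) →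
          (root , below-root a , below-root b) ,
          λ (_ , p , q) → [ a⋠b , b⋠a ]′ (⊑-total-above p q)

        child→ : ∀ {a b} → ChildOf _≼_ a b → Child (from a) (from b)
        child→ ((b≼a , b≢a) , cover) = covered-child b≼a (b≢a ∘ from-injective) λ u b⊑u b≢u u⊑a u≢a →
          cover (to u)
            ( (subst (_ ⊑_) (sym (from-to u)) b⊑u , λ e → b≢u (trans (cong from e) (from-to u)))
            , (subst (_⊑ _) (sym (from-to u)) u⊑a , λ e → u≢a (trans (sym (from-to u)) (cong from e))))

        child← : ∀ {a b} → Child (from a) (from b) → ChildOf _≼_ a b
        child← k = (child-⊑ k , child-≢ k ∘ cong from) , λ u ((b≼u , b≢u) , (u≼a , u≢a)) →
          [ b≢u ∘ from-injective , u≢a ∘ from-injective ]′ (child-covered k b≼u u≼a)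

        to-child : ∀ {a p} → Child (from a) p → ChildOf _≼_ a (to p)
        to-child k = child← (subst (Child _) (sym (from-to _)) k)

        childless→ : ∀ {a} → Leaf _≼_ a → ∀ q → ¬ Child (from a) q
        childless→ none q k = none (to q) (to-child k)

        factor : ∀ a → ¬ Leaf _≼_ a → Factor (ChildOf _≼_ a) κ
        factor a inner-node with factor-at (from a)
        ... | inj₁ none = ⊥-elim (inner-node λ b k → none _ (child→ k))
        ... | inj₂ F = map-factor to to-injective to-child
                (λ {b} k → from b , child→ k , to-from b)
                (λ x y → cong₂ color-at (from-to x) (from-to y)) F

        factor-color→ : ∀ {a z} → FactorColor _≼_ κ a z → Branch (from a) z
        factor-color→ (_ , _ , k , l , ne , e) = branch (child→ k) (child→ l) (ne ∘ from-injective) e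

        vertex-at : ∀ i → ∃ (At t i)
        vertex-at i = locate t (∈-allFin i)

        child-sibling : ∀ {r p q} → Child r p → Child r q → p ≢ q → Sibling _≼_ (to p) (to q)
        child-sibling {r} {p} {q} k l ne = (incomparable k l ne , incomparable l k (ne ∘ sym)) ,
          to r , to-child (subst (λ r → Child r _) (sym (from-to r)) k)
               , to-child (subst (λ r → Child r _) (sym (from-to r)) l)
          where
          incomparable : ∀ {p q} → Child r p → Child r q → p ≢ q → ¬ (to p ≼ to q)
          incomparable {p} {q} k l ne p≼q = [ ne , child-≢ l ]′
            (child-covered k (subst₂ _⊑_ (from-to p) (from-to q) p≼q) (child-⊑ l))

      treeRep : TreeRep c
      treeRep = record
        { m       = m
        ; _≤T_    = _≼_
        ; isTree  = ≼-isTree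
        ; col     = κ
        ; colSym  = λ r s _ → color-at-sym (from r) (from s)
        ; is2Col  = λ a ¬leaf → let (x , y , h) = factor-two-colors (factor a ¬leaf) in
                      x , y , λ _ _ → h
        ; f       = to ∘ proj₁ ∘ vertex-at
        ; f-inj   = λ {i} {j} e → at-injective (proj₂ (vertex-at i)) (proj₂ (vertex-at j)) (to-injective e)
        ; f-leaf  = λ i b k → at-childless (proj₂ (vertex-at i))
                      (subst (λ p → Child p _) (from-to _) (child→ k))
        ; f-onto  = λ a none → let (i , at) = childless-at (from a) (childless→ none) in
                      i , trans (cong to (at-functional (proj₂ (vertex-at i)) at)) (to-from a)
        ; f-color = λ i j ne →
                      let (r , b , p , q) = separate (proj₂ (vertex-at i)) (proj₂ (vertex-at j)) ne in
                      to (left b) , to (right b) ,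
                      child-sibling (left-child b) (right-child b) (left≢right b) ,
                      subst₂ _⊑_ (sym (from-to _)) (sym (from-to _)) p ,
                      subst₂ _⊑_ (sym (from-to _)) (sym (from-to _)) q ,
                      trans (cong₂ color-at (from-to _) (from-to _)) (branch-color b)
        ; irred   = λ a ¬leaf → factor-irreducible (factor a ¬leaf)
        ; simple  = λ a ¬leaf → factor-simple (factor a ¬leaf)
        ; layered = λ a b _ _ (a≼b , a≢b) z za zb →
                      layers a≼b (a≢b ∘ from-injective) (factor-color→ za) (factor-color→ zb)
        }

mainTheorem15 : {C : Set} (n : ℕ) → 1 ≤ n → (c : Fin n → Fin n → C) →
    (∀ i j → c i j ≡ c j i) →
    IsExactGallai c ⇔ TreeRep c
mainTheorem15 (suc n) _ c c-sym = mk⇔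
  (λ gallai → let open Decomposition c c-sym gallai in
    -- Any colour serves as default; the clique is nonempty, so `c zero zero` exists.
    Colored.treeRep (c zero zero) (grow (allFin (suc n)) (<-wellFounded _) (∈-allFin zero)))
  (FromTree.exactGallai c)
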